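{- Every $A\in\mathcal{L}_0$ has an ${\sf NNIL}({\sf par})$-projective resolution $\Pi$ such that every $B\in\Pi$ satisfies $c_\to(B)\le\max\{c_\to(A),1+\#{\sf par}\}$; moreover $\Pi$ is a computable function of $A$.
   Context: $\mathcal{L}_0$ is the propositional language with $\wedge,\vee,\to,\bot$ over a finite set of atoms ${\sf atom}={\sf var}\cup{\sf par}$ (disjoint finite sets of variables and parameters); $\vdash$ is ${\sf IPC}$-derivability; $\#{\sf par}$ is the number of parameters. A substitution commutes with the connectives, fixes $\bot$ and fixes every parameter. $\theta$ is $A$-projective if $A\vdash a\leftrightarrow\theta(a)$ for every atom $a$. For a set $\Gamma$ of formulas, $A$ is $\Gamma$-projective if there are an $A$-projective $\theta$ and $B\in\Gamma$ with $\vdash\theta(A)\leftrightarrow B$. ${\sf NNIL}$ is the least class containing atoms, $\bot,\top$, closed under $\wedge,\vee$, and containing $B\to C$ whenever $C\in{\sf NNIL}$ and $B$ is built from atoms, $\bot,\top$ by $\wedge,\vee$ only; ${\sf NNIL}({\sf par})$ is the set of ${\sf NNIL}$ formulas all of whose atoms are parameters. $\Gamma$-admissibility: $A\mathrel{|\!\sim_\Gamma}B$ iff for every substitution $\theta$ and every $C\in\Gamma$, $\vdash\theta(C\to A)$ implies $\vdash\theta(C\to B)$. A $\Gamma$-projective resolution of $A$ is a finite set $\Pi$ of formulas such that: for $B,C\in\Pi$, $\vdash B\to C$ implies $B=C$; every $B\in\Pi$ is $\Gamma$-projective; $A\mathrel{|\!\sim_\Gamma}\bigvee\Pi$; and $\vdash\bigvee\Pi\to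 A$. $c_\to$ is the implication nesting depth: $c_\to(a)=c_\to(\top)=c_\to(\bot)=0$, $c_\to(B\circ C)=\max\{c_\to(B),c_\to(C)\}$ for $\circ\in\{\wedge,\vee\}$, $c_\to(B\to C)=1+\max\{c_\to(B),c_\to(C)\}$. -}

module Defs where

open import Data.Nat using (ℕ; zero; suc; _⊔_; _≤_)
open import Data.Fin using (Fin)
open import Data.List using (List; []; _∷_; foldr)
open import Data.List.Membership.Propositional using (_∈_)
open import Data.Product using (Σ; _×_; _,_)
open import Relation.Binary.PropositionalEquality using (_≡_)

-- Formulas of L0 over variables Fin nv and parameters Fin np.
-- ⊤ is included as a primitive constant (the paper uses it, with c→(⊤)=0).
infixr 6 _∧_
infixr 5 _∨_
infixr 4 _⇒_
data Form (nv np : ℕ) : Set where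
  var : Fin nv → Form nv np
  par : Fin np → Form nv np
  ⊥' ⊤' : Form nv np
  _∧_ _∨_ _⇒_ : Form nv np → Form nv np → Form nv np

module _ {nv np : ℕ} where

  _⇔_ : Form nv np → Form nv np → Form nv np
  A ⇔ B = (A ⇒ B) ∧ (B ⇒ A)

  infix 2 _⊢_
  data _⊢_ (Δ : List (Form nv np)) : Form nv np → Set where
    ax   : ∀ {A} → A ∈ Δ → Δ ⊢ A
    ⊤I   : Δ ⊢ ⊤'
    ⊥E   : ∀ {A} → Δ ⊢ ⊥' → Δ ⊢ A
    ∧I   : ∀ {A B} → Δ ⊢ A → Δ ⊢ B → Δ ⊢ A ∧ B
    ∧E₁  : ∀ {A B} → Δ ⊢ A ∧ B → Δ ⊢ A
    ∧E₂  : ∀ {A B} → Δ ⊢ A ∧ B → Δ ⊢ B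
    ∨I₁  : ∀ {A B} → Δ ⊢ A → Δ ⊢ A ∨ B
    ∨I₂  : ∀ {A B} → Δ ⊢ B → Δ ⊢ A ∨ B
    ∨E   : ∀ {A B C} → Δ ⊢ A ∨ B → (A ∷ Δ) ⊢ C → (B ∷ Δ) ⊢ C → Δ ⊢ C
    ⇒I   : ∀ {A B} → (A ∷ Δ) ⊢ B → Δ ⊢ A ⇒ B
    ⇒E   : ∀ {A B} → Δ ⊢ A ⇒ B → Δ ⊢ A → Δ ⊢ B

  ⊢_ : Form nv np → Set
  ⊢ A = [] ⊢ A

  Subst : Set
  Subst = Fin nv → Form nv np

  sub : Subst → Form nv np → Form nv np
  sub θ (var x) = θ x
  sub θ (par p) = par p
  sub θ ⊥' = ⊥'
  sub θ ⊤' = ⊤'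
  sub θ (A ∧ B) = sub θ A ∧ sub θ B
  sub θ (A ∨ B) = sub θ A ∨ sub θ B
  sub θ (A ⇒ B) = sub θ A ⇒ sub θ B

  AProjective : Form nv np → Subst → Set
  AProjective A θ =
    (∀ x → (A ∷ []) ⊢ var x ⇔ sub θ (var x)) ×
    (∀ p → (A ∷ []) ⊢ par p ⇔ sub θ (par p))

  data ImpFree : Form nv np → Set where
    var : ∀ x → ImpFree (var x)
    par : ∀ p → ImpFree (par p)
    ⊥' : ImpFree ⊥'
    ⊤' : ImpFree ⊤'
    _∧_ : ∀ {A B} → ImpFree A → ImpFree B → ImpFree (A ∧ B)
    _∨_ : ∀ {A B} → ImpFree A → ImpFree B → ImpFree (A ∨ B)

  data NNIL : Form nv np → Set where
    var : ∀ x → NNIL (var x)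
    par : ∀ p → NNIL (par p)
    ⊥' : NNIL ⊥'
    ⊤' : NNIL ⊤'
    _∧_ : ∀ {A B} → NNIL A → NNIL B → NNIL (A ∧ B)
    _∨_ : ∀ {A B} → NNIL A → NNIL B → NNIL (A ∨ B)
    _⇒_ : ∀ {B C} → ImpFree B → NNIL C → NNIL (B ⇒ C)

  data ParOnly : Form nv np → Set where
    par : ∀ p → ParOnly (par p)
    ⊥' : ParOnly ⊥'
    ⊤' : ParOnly ⊤'
    _∧_ : ∀ {A B} → ParOnly A → ParOnly B → ParOnly (A ∧ B)
    _∨_ : ∀ {A B} → ParOnly A → ParOnly B → ParOnly (A ∨ B)
    _⇒_ : ∀ {A B} → ParOnly A → ParOnly B → ParOnly (A ⇒ B)

  NNILpar : Form nv np → Set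
  NNILpar B = NNIL B × ParOnly B

  ΓProjective : (Form nv np → Set) → Form nv np → Set
  ΓProjective Γ A = Σ Subst λ θ → Σ (Form nv np) λ B →
    AProjective A θ × Γ B × ⊢ (sub θ A ⇔ B)

  Admissible : (Form nv np → Set) → Form nv np → Form nv np → Set
  Admissible Γ A B = ∀ (θ : Subst) (C : Form nv np) → Γ C →
    ⊢ sub θ (C ⇒ A) → ⊢ sub θ (C ⇒ B)

  ⋁ : List (Form nv np) → Form nv np
  ⋁ = foldr _∨_ ⊥'

  record ProjResolution (Γ : Form nv np → Set) (A : Form nv np)
                        (Π : List (Form nv np)) : Set where
    field
      antichain  : ∀ {B C} → B ∈ Π → C ∈ Π → ⊢ (B ⇒ C) → B ≡ C
      projective : ∀ {B} → B ∈ Π → ΓProjective Γ B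
      admissible : Admissible Γ A (⋁ Π)
      derivable  : ⊢ (⋁ Π ⇒ A)

  c⇒ : Form nv np → ℕ
  c⇒ (var x) = 0
  c⇒ (par p) = 0
  c⇒ ⊥' = 0
  c⇒ ⊤' = 0
  c⇒ (A ∧ B) = c⇒ A ⊔ c⇒ B
  c⇒ (A ∨ B) = c⇒ A ⊔ c⇒ B
  c⇒ (A ⇒ B) = suc (c⇒ A ⊔ c⇒ B)

{-# OPTIONS --safe #-}
module Submission where

-- Put n = max (c⇒ A) (1 + np) and take the finitely many formulas of depth ≤ n up to
-- equivalence. Iterating Ghilardi's substitutions x ↦ D ⇒ x, x ↦ D ∧ x over all sets of
-- variables gives, for each D, a D-projective candidate unifier; Π consists of the weakest
-- conjunctions D ⊢ A for which this unifier turns D into an NNIL(par) formula, a decidable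
-- condition. If θ unifies A relative to C, let D be the conjunction of all formulas of depth
-- ≤ n that θ unifies relative to C. Suppose every point strictly above the root of a model of
-- C satisfies D. By the choice of D each such point has the same theory of depth n - 1 as
-- some θ-image of a model of C. Gluing these models under a new root gives again a model of
-- C, because C has depth ≤ np < n, and its θ-image shows which variables to make true at the
-- original root to obtain D there. By this extension property the candidate unifier of D
-- works relative to C.

open import Defs
open import Data.Bool using (Bool; true; false; T; if_then_else_)
open import Data.Bool.Properties using (T?)
open import Data.Empty using (⊥; ⊥-elim)
open import Data.Fin using (Fin)
import Data.Fin as Fin
open import Data.List
  using (List; []; _∷_; _++_; foldr; map; filter; length; concat; allFin; cartesianProductWith)
open import Data.List.Properties using (length-tabulate; length-filter)
open import Data.List.Membership.Propositional using (_∈_; find; lose)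
open import Data.List.Membership.Propositional.Properties
  using (∈-++⁺ˡ; ∈-++⁺ʳ; ∈-++⁻; ∈-map⁺; ∈-map⁻; ∈-filter⁺; ∈-filter⁻; ∈-concat⁺′; ∈-concat⁻′; ∈-allFin;
         ∈-cartesianProductWith⁺; ∈-cartesianProductWith⁻)
import Data.List.Membership.DecPropositional as DecMembership
open import Data.List.Relation.Unary.Any using (Any; here; there; _─_; any?)
open import Data.Nat using (ℕ; zero; suc; pred; _⊔_; _≤_; _<_; _+_; z≤n; s≤s; s≤s⁻¹)
open import Data.Nat.Properties
  using (≤-trans; ≤-refl; ≤-reflexive; +-suc; +-identityʳ; +-monoʳ-≤; n≤1+n; ⊔-lub; m≤m⊔n; m≤n⊔m;
         m⊔n≤o⇒m≤o; m⊔n≤o⇒n≤o; ≮⇒≥; <-irrefl)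
open import Data.Product using (Σ; ∃; _×_; _,_; proj₁; proj₂; swap)
open import Data.Sum using (_⊎_; inj₁; inj₂; [_,_]′)
open import Data.Unit using (⊤; tt)
open import Function using (_∘_; id; case_of_)
open import Relation.Binary.PropositionalEquality using (_≡_; refl; sym; trans; cong; cong₂; subst)
open import Relation.Nullary using (¬_; Dec; yes; no)
open import Relation.Nullary.Decidable
  using (map′; _×-dec_; _⊎-dec_; _→-dec_; ¬?; ⌊_⌋; toWitness; fromWitness)
open import Relation.Unary using (Decidable)
open import Data.Vec using (Vec; []; _∷_; lookup; tabulate; replicate)
open import Data.Vec.Properties using (lookup∘tabulate)

-- Finite lists: removal, choice, sublists and counting.

infix 1 _⟺_
_⟺_ : Set → Set → Set
P ⟺ Q = (P → Q) × (Q → P)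

─-∈ : ∀ {X : Set} {x y : X} {xs} (m : x ∈ xs) → y ∈ xs → y ≡ x ⊎ y ∈ (xs ─ m)
─-∈ (here refl) (here refl) = inj₁ refl
─-∈ (here refl) (there k)   = inj₂ k
─-∈ (there m)   (here refl) = inj₂ (here refl)
─-∈ (there m)   (there k)   with ─-∈ m k
... | inj₁ e = inj₁ e
... | inj₂ l = inj₂ (there l)

─-length : ∀ {X : Set} {x : X} {xs} (m : x ∈ xs) → suc (length (xs ─ m)) ≡ length xs
─-length (here refl) = refl
─-length {xs = _ ∷ _ ∷ _} (there m) = cong suc (─-length m)

─-⊆ : ∀ {X : Set} {x y : X} {xs} (m : x ∈ xs) → y ∈ (xs ─ m) → y ∈ xs
─-⊆ (here refl) k         = there k
─-⊆ (there m) (here refl) = here refl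
─-⊆ (there m) (there k)   = there (─-⊆ m k)

collect : ∀ {X P : Set} {Q : X → Set} (xs : List X) →
          (∀ {x} → x ∈ xs → P ⊎ Q x) → P ⊎ (∀ {x} → x ∈ xs → Q x)
collect [] f = inj₂ λ ()
collect (x ∷ xs) f with f (here refl) | collect xs (f ∘ there)
... | inj₁ p | _ = inj₁ p
... | inj₂ q | inj₁ p = inj₁ p
... | inj₂ q | inj₂ g = inj₂ λ { (here refl) → q ; (there m) → g m }

-- Finite choice, recording both where each chosen element comes from and that no entry is
-- forgotten; the successors of a countermodel and the gluing of models need both.
choose : ∀ {X Y : Set} {R : X → Y → Set} (xs : List X) → (∀ {x} → x ∈ xs → ∃ (R x)) →
         ∃ λ ys → (∀ {y} → y ∈ ys → ∃ λ x → x ∈ xs × R x y) ×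
                  (∀ {x} → x ∈ xs → ∃ λ y → y ∈ ys × R x y)
choose [] f = [] , (λ ()) , (λ ())
choose (x ∷ xs) f with f (here refl) | choose xs (f ∘ there)
... | y , r | ys , to , from = y ∷ ys ,
  (λ { (here refl) → x , here refl , r
     ; (there m) → let x′ , m′ , r′ = to m in x′ , there m′ , r′ }) ,
  (λ { (here refl) → y , here refl , r
     ; (there m) → let y′ , m′ , r′ = from m in y′ , there m′ , r′ })

sublists : ∀ {X : Set} → List X → List (List X)
sublists []       = [] ∷ []
sublists (x ∷ xs) = sublists xs ++ map (x ∷_) (sublists xs)

sublists-⊆ : ∀ {X : Set} (xs : List X) {ys y} → ys ∈ sublists xs → y ∈ ys → y ∈ xs
sublists-⊆ [] (here refl) ()
sublists-⊆ (x ∷ xs) m k with ∈-++⁻ (sublists xs) m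
... | inj₁ l = there (sublists-⊆ xs l k)
... | inj₂ l with ∈-map⁻ (x ∷_) l
... | zs , n , refl with k
... | here refl = here refl
... | there k′ = there (sublists-⊆ xs n k′)

filter∈sublists : ∀ {X : Set} {P : X → Set} (P? : Decidable P) xs → filter P? xs ∈ sublists xs
filter∈sublists P? [] = here refl
filter∈sublists P? (x ∷ xs) with P? x
... | yes _ = ∈-++⁺ʳ (sublists xs) (∈-map⁺ (x ∷_) (filter∈sublists P? xs))
... | no _  = ∈-++⁺ˡ (filter∈sublists P? xs)

allVecs : ∀ n → List (Vec Bool n)
allVecs zero    = [] ∷ []
allVecs (suc n) = cartesianProductWith _∷_ (true ∷ false ∷ []) (allVecs n)

∈-allVecs : ∀ {n} (v : Vec Bool n) → v ∈ allVecs n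
∈-allVecs []          = here refl
∈-allVecs (true ∷ v)  =
  ∈-cartesianProductWith⁺ _∷_ {xs = true ∷ false ∷ []} (here refl) (∈-allVecs v)
∈-allVecs (false ∷ v) =
  ∈-cartesianProductWith⁺ _∷_ {xs = true ∷ false ∷ []} (there (here refl)) (∈-allVecs v)

module _ {X : Set} {P Q : X → Set} (P? : Decidable P) (Q? : Decidable Q) where

  filter-mono : ∀ xs → (∀ {x} → x ∈ xs → P x → Q x) → length (filter P? xs) ≤ length (filter Q? xs)
  filter-mono [] h = z≤n
  filter-mono (x ∷ xs) h with P? x | Q? x
  ... | yes p | yes q = s≤s (filter-mono xs (h ∘ there))
  ... | yes p | no ¬q = ⊥-elim (¬q (h (here refl) p))
  ... | no ¬p | yes q = ≤-trans (filter-mono xs (h ∘ there)) (n≤1+n _)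
  ... | no ¬p | no ¬q = filter-mono xs (h ∘ there)

  -- Inclusion already gives one inequality between the counts, so the reverse one leaves no room
  -- for an entry satisfying only `Q`.
  filter-tight : ∀ xs → (∀ {x} → x ∈ xs → P x → Q x) → length (filter Q? xs) ≤ length (filter P? xs) →
                 ∀ {x} → x ∈ xs → Q x → P x
  filter-tight (x ∷ xs) h le m r with P? x | Q? x
  filter-tight (x ∷ xs) h (s≤s le) (there m) r | yes p | yes q = filter-tight xs (h ∘ there) le m r
  filter-tight (x ∷ xs) h le (here refl) r | yes p | _ = p
  filter-tight (x ∷ xs) h le (there m) r | yes p | no ¬q = ⊥-elim (¬q (h (here refl) p))
  filter-tight (x ∷ xs) h le m r | no ¬p | yes q =
    ⊥-elim (<-irrefl refl (≤-trans le (filter-mono xs (h ∘ there))))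
  filter-tight (x ∷ xs) h le (here refl) r | no ¬p | no ¬q = ⊥-elim (¬q r)
  filter-tight (x ∷ xs) h le (there m) r | no ¬p | no ¬q = filter-tight xs (h ∘ there) le m r

-- Maximal elements of a finite preorder.

module Antichain {X : Set} (_≼_ : X → X → Set) (_≼?_ : ∀ x y → Dec (x ≼ y))
                 (≼-refl : ∀ {x} → x ≼ x) (≼-trans : ∀ {x y z} → x ≼ y → y ≼ z → x ≼ z) where

  -- A newcomer below a kept element is dropped even if the two are equivalent, so at most one
  -- representative of each equivalence class survives and the antichain law can end in equality.
  insert : X → List X → List X
  insert x ys with any? (x ≼?_) ys
  ... | yes _ = ys
  ... | no _  = x ∷ filter (λ y → ¬? (y ≼? x)) ys

  prune : List X → List X
  prune = foldr insert []

  insert-⊆ : ∀ x ys {z} → z ∈ insert x ys → z ∈ x ∷ ys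
  insert-⊆ x ys m with any? (x ≼?_) ys
  insert-⊆ x ys m           | yes _ = there m
  insert-⊆ x ys (here refl) | no _  = here refl
  insert-⊆ x ys (there m)   | no _  = there (proj₁ (∈-filter⁻ (λ y → ¬? (y ≼? x)) {xs = ys} m))

  prune-⊆ : ∀ xs {z} → z ∈ prune xs → z ∈ xs
  prune-⊆ (x ∷ xs) m with insert-⊆ x (prune xs) m
  ... | here refl = here refl
  ... | there k   = there (prune-⊆ xs k)

  insert-cover : ∀ x ys {z} → z ∈ x ∷ ys → ∃ λ y → y ∈ insert x ys × z ≼ y
  insert-cover x ys m with any? (x ≼?_) ys
  insert-cover x ys (here refl) | yes p = let y , k , l = find p in y , k , l
  insert-cover x ys (there m)   | yes p = _ , m , ≼-refl
  insert-cover x ys (here refl) | no _  = x , here refl , ≼-refl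
  insert-cover x ys {z} (there m) | no _ with z ≼? x
  ... | yes l = x , here refl , l
  ... | no ¬l = z , there (∈-filter⁺ (λ y → ¬? (y ≼? x)) m ¬l) , ≼-refl

  prune-cover : ∀ xs {z} → z ∈ xs → ∃ λ y → y ∈ prune xs × z ≼ y
  prune-cover (x ∷ xs) (here refl) = insert-cover x (prune xs) (here refl)
  prune-cover (x ∷ xs) (there m) with prune-cover xs m
  ... | y , k , l with insert-cover x (prune xs) (there k)
  ...   | y′ , k′ , l′ = y′ , k′ , ≼-trans l l′

  IsAntichain : List X → Set
  IsAntichain xs = ∀ {y z} → y ∈ xs → z ∈ xs → y ≼ z → y ≡ z

  insert-antichain : ∀ x ys → IsAntichain ys → IsAntichain (insert x ys)
  insert-antichain x ys anti m n l with any? (x ≼?_) ys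
  ... | yes _ = anti m n l
  insert-antichain x ys anti (here refl) (here refl) l | no _ = refl
  insert-antichain x ys anti (here refl) (there n) l | no ¬p =
    ⊥-elim (¬p (lose (proj₁ (∈-filter⁻ (λ y → ¬? (y ≼? x)) {xs = ys} n)) l))
  insert-antichain x ys anti (there m) (here refl) l | no _ =
    ⊥-elim (proj₂ (∈-filter⁻ (λ y → ¬? (y ≼? x)) {xs = ys} m) l)
  insert-antichain x ys anti (there m) (there n) l | no _ =
    anti (proj₁ (∈-filter⁻ (λ y → ¬? (y ≼? x)) {xs = ys} m))
         (proj₁ (∈-filter⁻ (λ y → ¬? (y ≼? x)) {xs = ys} n)) l

  prune-antichain : ∀ xs → IsAntichain (prune xs)
  prune-antichain []       ()
  prune-antichain (x ∷ xs) = insert-antichain x (prune xs) (prune-antichain xs)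

-- Finite tree models: forcing, decidability and soundness.

module _ {nv np : ℕ} where

  private Fm = Form nv np

  data Tree : Set where
    node : (Fin nv → Bool) → (Fin np → Bool) → List Tree → Tree

  varAt : Fin nv → Tree → Bool
  varAt x (node vs _ _) = vs x

  parAt : Fin np → Tree → Bool
  parAt p (node _ ps _) = ps p

  infix 3 _⊑_
  data _⊑_ (J : Tree) : Tree → Set where
    root : J ⊑ J
    up   : ∀ {vs ps ts t} → t ∈ ts → J ⊑ t → J ⊑ node vs ps ts

  ⊑-trans : ∀ {I J K} → I ⊑ J → J ⊑ K → I ⊑ K
  ⊑-trans i root     = i
  ⊑-trans i (up m j) = up m (⊑-trans i j)

  -- Quantifying over all subtrees makes atoms persistent for arbitrary labels.
  infix 3 _⊩_
  _⊩_ : Tree → Fm → Set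
  K ⊩ var x   = ∀ J → J ⊑ K → T (varAt x J)
  K ⊩ par p   = ∀ J → J ⊑ K → T (parAt p J)
  K ⊩ ⊥'      = ⊥
  K ⊩ ⊤'      = ⊤
  K ⊩ (A ∧ B) = (K ⊩ A) × (K ⊩ B)
  K ⊩ (A ∨ B) = (K ⊩ A) ⊎ (K ⊩ B)
  K ⊩ (A ⇒ B) = ∀ J → J ⊑ K → J ⊩ A → J ⊩ B

  persist : ∀ A {J K} → J ⊑ K → K ⊩ A → J ⊩ A
  persist (var x) j k I i        = k I (⊑-trans i j)
  persist (par p) j k I i        = k I (⊑-trans i j)
  persist ⊤'      j k            = tt
  persist (A ∧ B) j (k , l)      = persist A j k , persist B j l
  persist (A ∨ B) j (inj₁ k)     = inj₁ (persist A j k)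
  persist (A ∨ B) j (inj₂ k)     = inj₂ (persist B j k)
  persist (A ⇒ B) j k I i        = k I (⊑-trans i j)

  module _ {P : Tree → Set} (P? : ∀ J → Dec (P J)) where

    -- Trees are finite, so a failure comes with an explicit point; `refuted-⇒` needs that point to
    -- produce countermodels constructively.
    everywhere : ∀ K → (∀ J → J ⊑ K → P J) ⊎ (∃ λ J → J ⊑ K × ¬ P J)
    everywhereAbove : ∀ ts → (∀ t → t ∈ ts → ∀ J → J ⊑ t → P J) ⊎
                             (∃ λ t → t ∈ ts × ∃ λ J → J ⊑ t × ¬ P J)

    everywhere K@(node vs ps ts) with P? K | everywhereAbove ts
    ... | no ¬p | _ = inj₂ (K , root , ¬p)
    ... | yes p | inj₂ (t , m , J , j , ¬p) = inj₂ (J , up m j , ¬p)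
    ... | yes p | inj₁ h = inj₁ λ { _ root → p ; J (up m j) → h _ m J j }

    everywhereAbove [] = inj₁ λ _ ()
    everywhereAbove (t ∷ ts) with everywhere t | everywhereAbove ts
    ... | inj₂ (J , j , ¬p) | _ = inj₂ (t , here refl , J , j , ¬p)
    ... | inj₁ h | inj₂ (s , m , r) = inj₂ (s , there m , r)
    ... | inj₁ h | inj₁ g = inj₁ λ { _ (here refl) → h ; s (there m) → g s m }

    everywhere? : ∀ K → Dec (∀ J → J ⊑ K → P J)
    everywhere? K with everywhere K
    ... | inj₁ h = yes h
    ... | inj₂ (J , j , ¬p) = no λ h → ¬p (h J j)

  infix 3 _⊩?_
  _⊩?_ : ∀ K A → Dec (K ⊩ A)
  K ⊩? var x   = everywhere? (λ J → T? (varAt x J)) K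
  K ⊩? par p   = everywhere? (λ J → T? (parAt p J)) K
  K ⊩? ⊥'      = no λ ()
  K ⊩? ⊤'      = yes tt
  K ⊩? (A ∧ B) = (K ⊩? A) ×-dec (K ⊩? B)
  K ⊩? (A ∨ B) = (K ⊩? A) ⊎-dec (K ⊩? B)
  K ⊩? (A ⇒ B) = everywhere? (λ J → (J ⊩? A) →-dec (J ⊩? B)) K

  refuted-⇒ : ∀ A B K → ¬ (K ⊩ A ⇒ B) → ∃ λ J → J ⊑ K × (J ⊩ A) × ¬ (J ⊩ B)
  refuted-⇒ A B K ¬ab with everywhere (λ J → (J ⊩? A) →-dec (J ⊩? B)) K
  ... | inj₁ h = ⊥-elim (¬ab h)
  ... | inj₂ (J , j , ¬h) with J ⊩? A
  ...   | yes a = J , j , a , λ b → ¬h λ _ → b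
  ...   | no ¬a = ⊥-elim (¬h λ a → ⊥-elim (¬a a))

  sound : ∀ {Δ A} → Δ ⊢ A → ∀ K → (∀ {B} → B ∈ Δ → K ⊩ B) → K ⊩ A
  sound (ax m) K h = h m
  sound ⊤I K h = tt
  sound (⊥E d) K h = ⊥-elim (sound d K h)
  sound (∧I d e) K h = sound d K h , sound e K h
  sound (∧E₁ d) K h = proj₁ (sound d K h)
  sound (∧E₂ d) K h = proj₂ (sound d K h)
  sound (∨I₁ d) K h = inj₁ (sound d K h)
  sound (∨I₂ d) K h = inj₂ (sound d K h)
  sound (∨E d e f) K h with sound d K h
  ... | inj₁ a = sound e K λ { (here refl) → a ; (there m) → h m }
  ... | inj₂ b = sound f K λ { (here refl) → b ; (there m) → h m }
  sound (⇒I d) K h J j a = sound d J λ { (here refl) → a ; (there {x = _} m) → persist _ j (h m) }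
  sound (⇒E d e) K h = sound d K h K root (sound e K h)

  weaken : ∀ {Γ Δ} {A : Fm} → (∀ {B} → B ∈ Γ → B ∈ Δ) → Γ ⊢ A → Δ ⊢ A
  lift : ∀ {Γ Δ} {C : Fm} → (∀ {B} → B ∈ Γ → B ∈ Δ) → ∀ {B} → B ∈ C ∷ Γ → B ∈ C ∷ Δ
  lift h (here e)  = here e
  lift h (there m) = there (h m)
  weaken h (ax m) = ax (h m)
  weaken h ⊤I = ⊤I
  weaken h (⊥E d) = ⊥E (weaken h d)
  weaken h (∧I d e) = ∧I (weaken h d) (weaken h e)
  weaken h (∧E₁ d) = ∧E₁ (weaken h d)
  weaken h (∧E₂ d) = ∧E₂ (weaken h d)
  weaken h (∨I₁ d) = ∨I₁ (weaken h d)
  weaken h (∨I₂ d) = ∨I₂ (weaken h d)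
  weaken h (∨E d e f) = ∨E (weaken h d) (weaken (lift h) e) (weaken (lift h) f)
  weaken h (⇒I d) = ⇒I (weaken (lift h) d)
  weaken h (⇒E d e) = ⇒E (weaken h d) (weaken h e)

  ⋁-intro : ∀ {Γ Δ} {A : Fm} → A ∈ Δ → Γ ⊢ A → Γ ⊢ ⋁ Δ
  ⋁-intro (here refl) d = ∨I₁ d
  ⋁-intro (there m)   d = ∨I₂ (⋁-intro m d)

  cut : ∀ {Γ Δ} {E : Fm} → E ∷ Γ ⊢ ⋁ Δ → Γ ⊢ ⋁ (E ∷ Δ) → Γ ⊢ ⋁ Δ
  cut d e = ∨E e d (ax (here refl))

  -- Completeness for finite tree models

  Model : List Fm → List Fm → Set
  Model Γ Δ = Σ Tree λ K → (∀ {E} → E ∈ Γ → K ⊩ E) × (∀ {E} → E ∈ Δ → ¬ (K ⊩ E))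

  Subs : Fm → List Fm → Set
  Subs (A ∧ B) S = A ∈ S × B ∈ S
  Subs (A ∨ B) S = A ∈ S × B ∈ S
  Subs (A ⇒ B) S = A ∈ S × B ∈ S
  Subs _       S = ⊤

  var∈? : ∀ x (Γ : List Fm) → Dec (var x ∈ Γ)
  var∈? x = any? λ { (var y) → map′ (cong var) (λ { refl → refl }) (x Fin.≟ y)
                   ; (par _) → no λ () ; ⊥' → no λ () ; ⊤' → no λ ()
                   ; (_ ∧ _) → no λ () ; (_ ∨ _) → no λ () ; (_ ⇒ _) → no λ () }

  par∈? : ∀ p (Γ : List Fm) → Dec (par p ∈ Γ)
  par∈? p = any? λ { (par q) → map′ (cong par) (λ { refl → refl }) (p Fin.≟ q)
                   ; (var _) → no λ () ; ⊥' → no λ () ; ⊤' → no λ ()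
                   ; (_ ∧ _) → no λ () ; (_ ∨ _) → no λ () ; (_ ⇒ _) → no λ () }

  module Search (S : List Fm) (closed : ∀ {E} → E ∈ S → Subs E S) where

    -- Here every formula of `S` has been put on one side. Each check below yields a derivation or
    -- confirms one saturation condition; `child` supplies the recursive search for a successor
    -- refuting an implication.
    module Leaf (Γ Δ : List Fm) (Γ⊆S : ∀ {E} → E ∈ Γ → E ∈ S) (Δ⊆S : ∀ {E} → E ∈ Δ → E ∈ S)
                (status : ∀ {E} → E ∈ S → E ∈ Γ ⊎ E ∈ Δ)
                (child : ∀ {A B} → A ∈ Δ → B ∈ Δ → (Γ ⊢ A ⇒ B) ⊎ Model (A ∷ Γ) (B ∷ [])) where

      Ok⁺ : Fm → Set
      Ok⁺ ⊥'      = ⊥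
      Ok⁺ (A ∧ B) = A ∈ Γ × B ∈ Γ
      Ok⁺ (A ∨ B) = A ∈ Γ ⊎ B ∈ Γ
      Ok⁺ (A ⇒ B) = A ∈ Δ ⊎ B ∈ Γ
      Ok⁺ _       = ⊤

      Ok⁻ : Fm → Set
      Ok⁻ (var x) = ¬ (var x ∈ Γ)
      Ok⁻ (par p) = ¬ (par p ∈ Γ)
      Ok⁻ ⊥'      = ⊤
      Ok⁻ ⊤'      = ⊥
      Ok⁻ (A ∧ B) = A ∈ Δ ⊎ B ∈ Δ
      Ok⁻ (A ∨ B) = A ∈ Δ × B ∈ Δ
      Ok⁻ (A ⇒ B) = (A ∈ Γ × B ∈ Δ) ⊎ Model (A ∷ Γ) (B ∷ [])

      check⁺ : ∀ E → E ∈ Γ → (Γ ⊢ ⋁ Δ) ⊎ Ok⁺ E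
      check⁺ (var x) m = inj₂ tt
      check⁺ (par p) m = inj₂ tt
      check⁺ ⊤' m = inj₂ tt
      check⁺ ⊥' m = inj₁ (⊥E (ax m))
      check⁺ (A ∧ B) m with closed (Γ⊆S m)
      ... | a , b with status a | status b
      ... | inj₁ a | inj₁ b = inj₂ (a , b)
      ... | inj₂ a | _      = inj₁ (⋁-intro a (∧E₁ (ax m)))
      ... | _      | inj₂ b = inj₁ (⋁-intro b (∧E₂ (ax m)))
      check⁺ (A ∨ B) m with closed (Γ⊆S m)
      ... | a , b with status a | status b
      ... | inj₁ a | _      = inj₂ (inj₁ a)
      ... | _      | inj₁ b = inj₂ (inj₂ b)
      ... | inj₂ a | inj₂ b = inj₁ (∨E (ax m) (⋁-intro a (ax (here refl))) (⋁-intro b (ax (here refl))))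
      check⁺ (A ⇒ B) m with closed (Γ⊆S m)
      ... | a , b with status a | status b
      ... | inj₂ a | _      = inj₂ (inj₁ a)
      ... | _      | inj₁ b = inj₂ (inj₂ b)
      ... | inj₁ a | inj₂ b = inj₁ (⋁-intro b (⇒E (ax m) (ax a)))

      check⁻ : ∀ E → E ∈ Δ → (Γ ⊢ ⋁ Δ) ⊎ Ok⁻ E
      check⁻ (var x) m with var∈? x Γ
      ... | yes g = inj₁ (⋁-intro m (ax g))
      ... | no ¬g = inj₂ ¬g
      check⁻ (par p) m with par∈? p Γ
      ... | yes g = inj₁ (⋁-intro m (ax g))
      ... | no ¬g = inj₂ ¬g
      check⁻ ⊥' m = inj₂ tt
      check⁻ ⊤' m = inj₁ (⋁-intro m ⊤I)
      check⁻ (A ∧ B) m with closed (Δ⊆S m)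
      ... | a , b with status a | status b
      ... | inj₂ a | _      = inj₂ (inj₁ a)
      ... | _      | inj₂ b = inj₂ (inj₂ b)
      ... | inj₁ a | inj₁ b = inj₁ (⋁-intro m (∧I (ax a) (ax b)))
      check⁻ (A ∨ B) m with closed (Δ⊆S m)
      ... | a , b with status a | status b
      ... | inj₂ a | inj₂ b = inj₂ (a , b)
      ... | inj₁ a | _      = inj₁ (⋁-intro m (∨I₁ (ax a)))
      ... | _      | inj₁ b = inj₁ (⋁-intro m (∨I₂ (ax b)))
      check⁻ (A ⇒ B) m with closed (Δ⊆S m)
      ... | a , b with status a | status b
      ... | _      | inj₁ b = inj₁ (⋁-intro m (⇒I (ax (there b))))
      ... | inj₁ a | inj₂ b = inj₂ (inj₁ (a , b))
      ... | inj₂ a | inj₂ b with child a b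
      ...   | inj₁ d = inj₁ (⋁-intro m d)
      ...   | inj₂ M = inj₂ (inj₂ M)

      module Build (ok⁺ : ∀ {E} → E ∈ Γ → Ok⁺ E) (ok⁻ : ∀ {E} → E ∈ Δ → Ok⁻ E) where

        Requested : Fm → List Tree → Set
        Requested (A ⇒ B) ts = (A ∈ Γ × B ∈ Δ) ⊎ ∃ λ t → t ∈ ts × (t ⊩ A) × ¬ (t ⊩ B)
        Requested _       ts = ⊤

        Serves : Fm → List Tree → Set
        Serves E ts = (∀ {t} → t ∈ ts → ∀ {G} → G ∈ Γ → t ⊩ G) × Requested E ts

        serve : ∀ E → E ∈ Δ → ∃ (Serves E)
        serve (A ⇒ B) m with ok⁻ m
        ... | inj₁ r = [] , (λ ()) , inj₁ r
        ... | inj₂ (K , pos , neg) = K ∷ [] , (λ { (here refl) g → pos (there g) }) ,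
                                     inj₂ (K , here refl , pos (here refl) , neg (here refl))
        serve (var x) m = [] , (λ ()) , tt
        serve (par p) m = [] , (λ ()) , tt
        serve ⊥' m      = [] , (λ ()) , tt
        serve ⊤' m      = [] , (λ ()) , tt
        serve (A ∧ B) m = [] , (λ ()) , tt
        serve (A ∨ B) m = [] , (λ ()) , tt

        groups = choose {R = Serves} Δ (λ {E} → serve E)
        ts = concat (proj₁ groups)

        above : ∀ {t} → t ∈ ts → ∀ {E} → E ∈ Γ → t ⊩ E
        above m with ∈-concat⁻′ (proj₁ groups) m
        ... | us , k , l = proj₁ (proj₂ (proj₂ (proj₁ (proj₂ groups) l))) k

        served : ∀ {A B} → (A ⇒ B) ∈ Δ → Requested (A ⇒ B) ts
        served m with proj₂ (proj₂ groups) m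
        ... | us , l , _ , inj₁ r = inj₁ r
        ... | us , l , _ , inj₂ (t , k , r) = inj₂ (t , ∈-concat⁺′ k l , r)

        K : Tree
        K = node (λ x → ⌊ var∈? x Γ ⌋) (λ p → ⌊ par∈? p Γ ⌋) ts

        -- Every successor was built to force all of `Γ`, so the saturation conditions are needed
        -- only at the root. An implication on the right fails at the root itself or at the
        -- successor requested for it.
        truth : ∀ E → (E ∈ Γ → K ⊩ E) × (E ∈ Δ → ¬ (K ⊩ E))
        truth (var x) = (λ { m _ root → fromWitness m ; m J (up t j) → above t m J j }) ,
                        λ m k → ok⁻ m (toWitness (k K root))
        truth (par p) = (λ { m _ root → fromWitness m ; m J (up t j) → above t m J j }) ,
                        λ m k → ok⁻ m (toWitness (k K root))
        truth ⊥' = (λ m → ok⁺ m) , λ _ ()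
        truth ⊤' = (λ _ → tt) , λ m _ → ok⁻ m
        truth (A ∧ B) = (λ m → proj₁ (truth A) (proj₁ (ok⁺ m)) , proj₁ (truth B) (proj₂ (ok⁺ m))) ,
          λ { m (a , b) → [ (λ n → proj₂ (truth A) n a) , (λ n → proj₂ (truth B) n b) ]′ (ok⁻ m) }
        truth (A ∨ B) = (λ m → [ inj₁ ∘ proj₁ (truth A) , inj₂ ∘ proj₁ (truth B) ]′ (ok⁺ m)) ,
          λ m → [ proj₂ (truth A) (proj₁ (ok⁻ m)) , proj₂ (truth B) (proj₂ (ok⁻ m)) ]′
        truth (A ⇒ B) =
          (λ { m J (up t j) a → above t m J j a
             ; m _ root a → [ (λ n → ⊥-elim (proj₂ (truth A) n a)) , proj₁ (truth B) ]′ (ok⁺ m) }) ,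
          λ m k → [ (λ { (a , b) → proj₂ (truth B) b (k K root (proj₁ (truth A) a)) }) ,
                    (λ { (t , n , a , ¬b) → ¬b (k t (up n root) a) }) ]′ (served m)

      leaf : (Γ ⊢ ⋁ Δ) ⊎ Model Γ Δ
      leaf with collect Γ (λ {E} → check⁺ E) | collect Δ (λ {E} → check⁻ E)
      ... | inj₁ d | _      = inj₁ d
      ... | inj₂ _ | inj₁ d = inj₁ d
      ... | inj₂ ok⁺ | inj₂ ok⁻ = inj₂ (K , proj₁ (truth _) , proj₂ (truth _))
        where open Build ok⁺ ok⁻

    -- `U` holds the formulas not yet assigned. Each is tried on the left, then on the right, and
    -- two derivations are joined by cut. The bound `k` drops on passing to a successor, where the
    -- antecedent moves into `Γ` for good and the refuted formulas other than the consequent become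
    -- undecided again.
    search : ∀ k Γ Δ U → (∀ {E} → E ∈ Γ → E ∈ S) → (∀ {E} → E ∈ Δ → E ∈ S) → (∀ {E} → E ∈ U → E ∈ S) →
             (∀ {E} → E ∈ S → E ∈ Γ ⊎ E ∈ Δ ⊎ E ∈ U) → length Δ + length U ≤ k →
             (Γ ⊢ ⋁ Δ) ⊎ Model Γ Δ
    search k Γ Δ [] g d u st le = Leaf.leaf Γ Δ g d status (child k le)
      where
        status : ∀ {E} → E ∈ S → E ∈ Γ ⊎ E ∈ Δ
        status m with st m
        ... | inj₁ x = inj₁ x
        ... | inj₂ (inj₁ x) = inj₂ x
        child : ∀ k → length Δ + 0 ≤ k → ∀ {A B} → A ∈ Δ → B ∈ Δ → (Γ ⊢ A ⇒ B) ⊎ Model (A ∷ Γ) (B ∷ [])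
        -- An implication between equal formulas is derivable; otherwise the two sides are different
        -- entries of `Δ` and both can be removed.
        child k le {A} {B} a b with ─-∈ a b
        ... | inj₁ refl = inj₁ (⇒I (ax (here refl)))
        child zero le (here _) b | inj₂ b′ with () ← le
        child zero le (there _) b | inj₂ b′ with () ← le
        child (suc k) le {A} {B} a b | inj₂ b′ =
          [ (λ e → inj₁ (⇒I (∨E e (ax (here refl)) (⊥E (ax (here refl)))))) , inj₂ ]′
            (search k (A ∷ Γ) (B ∷ []) rest
              (λ { (here refl) → d a ; (there m) → g m }) (λ { (here refl) → d b })
              (λ m → d (─-⊆ a (─-⊆ b′ m))) status′ bound)
          where
            rest = (Δ ─ a) ─ b′
            status′ : ∀ {E} → E ∈ S → E ∈ A ∷ Γ ⊎ E ∈ B ∷ [] ⊎ E ∈ rest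
            status′ m with status m
            ... | inj₁ x = inj₁ (there x)
            ... | inj₂ x with ─-∈ a x
            ...   | inj₁ refl = inj₁ (here refl)
            ...   | inj₂ y with ─-∈ b′ y
            ...     | inj₁ refl = inj₂ (inj₁ (here refl))
            ...     | inj₂ z = inj₂ (inj₂ z)
            -- Two entries leave `Δ` and only the consequent returns, so the measure falls by one.
            bound : suc (length rest) ≤ k
            bound = s≤s⁻¹ (≤-trans (≤-reflexive (trans (cong suc (─-length b′))
                      (trans (─-length a) (sym (+-identityʳ _))))) le)
    search k Γ Δ (E ∷ U) g d u st le
      with search k (E ∷ Γ) Δ U (λ { (here refl) → u (here refl) ; (there m) → g m }) d (u ∘ there)
             (λ m → case st m of λ { (inj₁ x) → inj₁ (there x)
                                   ; (inj₂ (inj₁ x)) → inj₂ (inj₁ x)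
                                   ; (inj₂ (inj₂ (here refl))) → inj₁ (here refl)
                                   ; (inj₂ (inj₂ (there x))) → inj₂ (inj₂ x) })
             (≤-trans (+-monoʳ-≤ (length Δ) (n≤1+n (length U))) le)
    ... | inj₂ (K , pos , neg) = inj₂ (K , pos ∘ there , neg)
    ... | inj₁ p
      with search k Γ (E ∷ Δ) U g (λ { (here refl) → u (here refl) ; (there m) → d m }) (u ∘ there)
             (λ m → case st m of λ { (inj₁ x) → inj₁ x
                                   ; (inj₂ (inj₁ x)) → inj₂ (inj₁ (there x))
                                   ; (inj₂ (inj₂ (here refl))) → inj₂ (inj₁ (here refl))
                                   ; (inj₂ (inj₂ (there x))) → inj₂ (inj₂ x) })
             (subst (_≤ k) (+-suc (length Δ) (length U)) le)
    ...   | inj₂ (K , pos , neg) = inj₂ (K , pos , neg ∘ there)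
    ...   | inj₁ q = inj₁ (cut {Δ = Δ} p q)

  subformulas : Fm → List Fm
  proper : Fm → List Fm
  subformulas A = A ∷ proper A
  proper (A ∧ B) = subformulas A ++ subformulas B
  proper (A ∨ B) = subformulas A ++ subformulas B
  proper (A ⇒ B) = subformulas A ++ subformulas B
  proper _ = []

  Subs-mono : ∀ E {S T} → (∀ {F} → F ∈ S → F ∈ T) → Subs E S → Subs E T
  Subs-mono (A ∧ B) h (a , b) = h a , h b
  Subs-mono (A ∨ B) h (a , b) = h a , h b
  Subs-mono (A ⇒ B) h (a , b) = h a , h b
  Subs-mono (var x) h s = tt
  Subs-mono (par p) h s = tt
  Subs-mono ⊥' h s = tt
  Subs-mono ⊤' h s = tt

  subformulas-closed : ∀ A {E} → E ∈ subformulas A → Subs E (subformulas A)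
  pair-closed : ∀ A B {E F} → E ∈ subformulas A ++ subformulas B →
                Subs E (F ∷ subformulas A ++ subformulas B)
  pair-closed A B {E} m with ∈-++⁻ (subformulas A) m
  ... | inj₁ a = Subs-mono E (there ∘ ∈-++⁺ˡ) (subformulas-closed A a)
  ... | inj₂ b = Subs-mono E (there ∘ ∈-++⁺ʳ (subformulas A)) (subformulas-closed B b)
  subformulas-closed (var x) (here refl) = tt
  subformulas-closed (par p) (here refl) = tt
  subformulas-closed ⊥' (here refl) = tt
  subformulas-closed ⊤' (here refl) = tt
  subformulas-closed (A ∧ B) (here refl) = there (here refl) , there (∈-++⁺ʳ (subformulas A) (here refl))
  subformulas-closed (A ∧ B) (there m) = pair-closed A B m
  subformulas-closed (A ∨ B) (here refl) = there (here refl) , there (∈-++⁺ʳ (subformulas A) (here refl))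
  subformulas-closed (A ∨ B) (there m) = pair-closed A B m
  subformulas-closed (A ⇒ B) (here refl) = there (here refl) , there (∈-++⁺ʳ (subformulas A) (here refl))
  subformulas-closed (A ⇒ B) (there m) = pair-closed A B m

  abstract
    decide : ∀ A → (⊢ A) ⊎ ∃ λ K → ¬ (K ⊩ A)
    decide A with search _ [] (A ∷ []) (subformulas A) (λ ()) (λ { (here refl) → here refl }) id
                         (inj₂ ∘ inj₂) ≤-refl
      where open Search (subformulas A) (subformulas-closed A)
    ... | inj₁ d = inj₁ (∨E d (ax (here refl)) (⊥E (ax (here refl))))
    ... | inj₂ (K , _ , neg) = inj₂ (K , neg (here refl))

  complete : ∀ {A} → (∀ K → K ⊩ A) → ⊢ A
  complete {A} h with decide A
  ... | inj₁ d = d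
  ... | inj₂ (K , ¬a) = ⊥-elim (¬a (h K))

  valid : ∀ {A} → ⊢ A → ∀ K → K ⊩ A
  valid d K = sound d K λ ()

  ⊢? : ∀ A → Dec (⊢ A)
  ⊢? A with decide A
  ... | inj₁ d = yes d
  ... | inj₂ (K , ¬a) = no λ d → ¬a (valid d K)

  -- Substitutions, semantic equivalence and finite conjunctions and disjunctions.

  sub-⊢ : ∀ (σ : Subst) {Γ A} → Γ ⊢ A → map (sub σ) Γ ⊢ sub {nv} {np} σ A
  sub-⊢ σ (ax m) = ax (∈-map⁺ (sub σ) m)
  sub-⊢ σ ⊤I = ⊤I
  sub-⊢ σ (⊥E d) = ⊥E (sub-⊢ σ d)
  sub-⊢ σ (∧I d e) = ∧I (sub-⊢ σ d) (sub-⊢ σ e)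
  sub-⊢ σ (∧E₁ d) = ∧E₁ (sub-⊢ σ d)
  sub-⊢ σ (∧E₂ d) = ∧E₂ (sub-⊢ σ d)
  sub-⊢ σ (∨I₁ d) = ∨I₁ (sub-⊢ σ d)
  sub-⊢ σ (∨I₂ d) = ∨I₂ (sub-⊢ σ d)
  sub-⊢ σ (∨E d e f) = ∨E (sub-⊢ σ d) (sub-⊢ σ e) (sub-⊢ σ f)
  sub-⊢ σ (⇒I d) = ⇒I (sub-⊢ σ d)
  sub-⊢ σ (⇒E d e) = ⇒E (sub-⊢ σ d) (sub-⊢ σ e)

  sub-parOnly : ∀ (σ : Subst) {C : Fm} → ParOnly C → sub σ C ≡ C
  sub-parOnly σ (par p) = refl
  sub-parOnly σ ⊥' = refl
  sub-parOnly σ ⊤' = refl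
  sub-parOnly σ (a ∧ b) = cong₂ _∧_ (sub-parOnly σ a) (sub-parOnly σ b)
  sub-parOnly σ (a ∨ b) = cong₂ _∨_ (sub-parOnly σ a) (sub-parOnly σ b)
  sub-parOnly σ (a ⇒ b) = cong₂ _⇒_ (sub-parOnly σ a) (sub-parOnly σ b)

  infix 1 _≋_
  _≋_ : Fm → Fm → Set
  A ≋ B = ∀ K → (K ⊩ A) ⟺ (K ⊩ B)

  ≋⇒⊢ : ∀ {A B} → A ≋ B → ⊢ (A ⇔ B)
  ≋⇒⊢ e = complete λ _ → (λ J _ → proj₁ (e J)) , (λ J _ → proj₂ (e J))

  ⊢⇒≋ : ∀ {A B : Fm} → ⊢ (A ⇔ B) → A ≋ B
  ⊢⇒≋ d K with valid d K
  ... | f , g = f K root , g K root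

  -- Completeness turns the equivalence into a derivation, and derivations are closed under
  -- substitution.
  ≋-sub : ∀ (σ : Subst) {A B} → A ≋ B → sub σ A ≋ sub σ B
  ≋-sub σ e = ⊢⇒≋ (sub-⊢ σ (≋⇒⊢ e))

  ⋀ : List Fm → Fm
  ⋀ = foldr _∧_ ⊤'

  ⋀-sub⁺ : ∀ (σ : Subst) {K} X → (∀ {E} → E ∈ X → K ⊩ sub σ E) → K ⊩ sub σ (⋀ X)
  ⋀-sub⁺ σ [] h = tt
  ⋀-sub⁺ σ (E ∷ X) h = h (here refl) , ⋀-sub⁺ σ X (h ∘ there)

  ⋀-sub⁻ : ∀ (σ : Subst) {K X E} → E ∈ X → K ⊩ sub σ (⋀ X) → K ⊩ sub σ E
  ⋀-sub⁻ σ (here refl) (k , _) = k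
  ⋀-sub⁻ σ (there m)   (_ , k) = ⋀-sub⁻ σ m k

  ⋁-sub⁺ : ∀ (σ : Subst) {K X E} → E ∈ X → K ⊩ sub σ E → K ⊩ sub σ (⋁ X)
  ⋁-sub⁺ σ (here refl) k = inj₁ k
  ⋁-sub⁺ σ (there m)   k = inj₂ (⋁-sub⁺ σ m k)

  ⋁-sub⁻ : ∀ (σ : Subst) {K} X → K ⊩ sub σ (⋁ X) → ∃ λ E → E ∈ X × (K ⊩ sub σ E)
  ⋁-sub⁻ σ (E ∷ X) (inj₁ k) = E , here refl , k
  ⋁-sub⁻ σ (E ∷ X) (inj₂ k) with ⋁-sub⁻ σ X k
  ... | F , m , l = F , there m , l

  ⋀⁺ : ∀ {K} X → (∀ {E} → E ∈ X → K ⊩ E) → K ⊩ ⋀ X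
  ⋀⁺ [] h = tt
  ⋀⁺ (E ∷ X) h = h (here refl) , ⋀⁺ X (h ∘ there)

  ⋀⁻ : ∀ {K X E} → E ∈ X → K ⊩ ⋀ X → K ⊩ E
  ⋀⁻ (here refl) (k , _) = k
  ⋀⁻ (there m)   (_ , k) = ⋀⁻ m k

  ⋁⁺ : ∀ {K X E} → E ∈ X → K ⊩ E → K ⊩ ⋁ X
  ⋁⁺ (here refl) k = inj₁ k
  ⋁⁺ (there m)   k = inj₂ (⋁⁺ m k)

  ⋁⁻ : ∀ {K} X → K ⊩ ⋁ X → ∃ λ E → E ∈ X × (K ⊩ E)
  ⋁⁻ (E ∷ X) (inj₁ k) = E , here refl , k
  ⋁⁻ (E ∷ X) (inj₂ k) with ⋁⁻ X k
  ... | F , m , l = F , there m , l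

  -- Finitely many formulas of bounded depth

  data Positive (G : List Fm) : Fm → Set where
    gen : ∀ {E} → E ∈ G → Positive G E
    ⊥'  : Positive G ⊥'
    ⊤'  : Positive G ⊤'
    _∧_ : ∀ {A B} → Positive G A → Positive G B → Positive G (A ∧ B)
    _∨_ : ∀ {A B} → Positive G A → Positive G B → Positive G (A ∨ B)

  positive-mono : ∀ {G E K J} → (∀ {F} → F ∈ G → K ⊩ F → J ⊩ F) → Positive G E → K ⊩ E → J ⊩ E
  positive-mono h (gen m) k = h m k
  positive-mono h ⊤' k = tt
  positive-mono h (a ∧ b) (k , l) = positive-mono h a k , positive-mono h b l
  positive-mono h (a ∨ b) (inj₁ k) = inj₁ (positive-mono h a k)
  positive-mono h (a ∨ b) (inj₂ k) = inj₂ (positive-mono h b k)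

  dnfs : List Fm → List Fm
  dnfs G = map (⋁ ∘ map ⋀) (sublists (sublists G))

  -- Take all conjunctions of generators that imply `E`. At a point forcing `E`, the generators
  -- forced there form such a conjunction, because the truth of `E` depends monotonically on them.
  dnf : ∀ {G E} → Positive G E → ∃ λ E′ → E′ ∈ dnfs G × (E ≋ E′)
  dnf {G} {E} pos = ⋁ (map ⋀ (filter implies? (sublists G))) ,
    ∈-map⁺ _ (filter∈sublists implies? (sublists G)) , λ K → to K , from K
    where
      implies? = λ X → ⊢? (⋀ X ⇒ E)
      from : ∀ K → K ⊩ ⋁ (map ⋀ (filter implies? (sublists G))) → K ⊩ E
      from K k with ⋁⁻ (map ⋀ (filter implies? (sublists G))) k
      ... | _ , m , l with ∈-map⁻ ⋀ m
      ... | X , n , refl = valid (proj₂ (∈-filter⁻ implies? {xs = sublists G} n)) K K root l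
      to : ∀ K → K ⊩ E → K ⊩ ⋁ (map ⋀ (filter implies? (sublists G)))
      to K k = ⋁⁺ (∈-map⁺ ⋀ (∈-filter⁺ implies? (filter∈sublists (K ⊩?_) G) X⊢E))
                  (⋀⁺ X (proj₂ ∘ ∈-filter⁻ (K ⊩?_) {xs = G}))
        where
          X = filter (K ⊩?_) G
          X⊢E : ⊢ (⋀ X ⇒ E)
          X⊢E = complete λ _ J _ j → positive-mono (λ m l → ⋀⁻ (∈-filter⁺ (K ⊩?_) m l) j) pos k

  module _ {Q : Fm → Set} (q⊥ : Q ⊥') (q⊤ : Q ⊤') (q∧ : ∀ {A B} → Q A → Q B → Q (A ∧ B))
           (q∨ : ∀ {A B} → Q A → Q B → Q (A ∨ B)) where

    ⋀-closed : ∀ X → (∀ {E} → E ∈ X → Q E) → Q (⋀ X)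
    ⋀-closed []      h = q⊤
    ⋀-closed (E ∷ X) h = q∧ (h (here refl)) (⋀-closed X (h ∘ there))

    ⋁-closed : ∀ X → (∀ {E} → E ∈ X → Q E) → Q (⋁ X)
    ⋁-closed []      h = q⊥
    ⋁-closed (E ∷ X) h = q∨ (h (here refl)) (⋁-closed X (h ∘ there))

    dnfs-closed : ∀ {G} → (∀ {E} → E ∈ G → Q E) → ∀ {E} → E ∈ dnfs G → Q E
    dnfs-closed {G} h m with ∈-map⁻ (⋁ ∘ map ⋀) m
    ... | S , n , refl = ⋁-closed (map ⋀ S) λ k → case ∈-map⁻ ⋀ k of λ
      { (X , l , refl) → ⋀-closed X (h ∘ sublists-⊆ G (sublists-⊆ (sublists G) n l)) }

  params atoms : List Fm
  params = map par (allFin np)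
  atoms  = map var (allFin nv) ++ params

  implications : ℕ → List Fm
  formulas : ℕ → List Fm
  implications zero    = []
  implications (suc n) = cartesianProductWith _⇒_ (formulas n) (formulas n)
  formulas n = dnfs (atoms ++ implications n)

  par∈params : ∀ p → par p ∈ params
  par∈params p = ∈-map⁺ par (∈-allFin p)

  ∈-atoms-depth : ∀ {E} → E ∈ atoms → c⇒ E ≡ 0
  ∈-atoms-depth m with ∈-++⁻ (map var (allFin nv)) m
  ... | inj₁ k with ∈-map⁻ var k
  ... | _ , _ , refl = refl
  ∈-atoms-depth m | inj₂ k with ∈-map⁻ par k
  ... | _ , _ , refl = refl

  formulas-depth : ∀ n {E} → E ∈ formulas n → c⇒ E ≤ n
  formulas-depth n = dnfs-closed z≤n z≤n ⊔-lub ⊔-lub (generators n)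
    where
      generators : ∀ n {E} → E ∈ atoms ++ implications n → c⇒ E ≤ n
      generators n m with ∈-++⁻ atoms m
      ... | inj₁ a = ≤-trans (≤-reflexive (∈-atoms-depth a)) z≤n
      generators (suc n) m | inj₂ i with ∈-cartesianProductWith⁻ _⇒_ (formulas n) (formulas n) i
      ... | _ , _ , a , b , refl = s≤s (⊔-lub (formulas-depth n a) (formulas-depth n b))

  ⇒-cong : ∀ {A A′ B B′} → A ≋ A′ → B ≋ B′ → (A ⇒ B) ≋ (A′ ⇒ B′)
  ⇒-cong e f K = (λ h J j a → proj₁ (f J) (h J j (proj₂ (e J) a))) ,
                 (λ h J j a → proj₂ (f J) (h J j (proj₁ (e J) a)))

  -- Outermost implications become generators once both sides are normalised one level down;
  -- everything around them is positive.
  positive-form : ∀ n E → c⇒ E ≤ n → ∃ λ E′ → Positive (atoms ++ implications n) E′ × (E ≋ E′)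
  normal-form : ∀ n E → c⇒ E ≤ n → ∃ λ E′ → E′ ∈ formulas n × (E ≋ E′)

  positive-form n (var x) le = var x , gen (∈-++⁺ˡ (∈-++⁺ˡ (∈-map⁺ var (∈-allFin x)))) , λ _ → id , id
  positive-form n (par p) le =
    par p , gen (∈-++⁺ˡ (∈-++⁺ʳ (map var (allFin nv)) (par∈params p))) , λ _ → id , id
  positive-form n ⊥' le = ⊥' , ⊥' , λ _ → id , id
  positive-form n ⊤' le = ⊤' , ⊤' , λ _ → id , id
  positive-form n (A ∧ B) le
    with positive-form n A (m⊔n≤o⇒m≤o _ _ le) | positive-form n B (m⊔n≤o⇒n≤o _ _ le)
  ... | A′ , a , e | B′ , b , f = A′ ∧ B′ , a ∧ b , λ K →
    (λ (k , l) → proj₁ (e K) k , proj₁ (f K) l) , (λ (k , l) → proj₂ (e K) k , proj₂ (f K) l)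
  positive-form n (A ∨ B) le
    with positive-form n A (m⊔n≤o⇒m≤o _ _ le) | positive-form n B (m⊔n≤o⇒n≤o _ _ le)
  ... | A′ , a , e | B′ , b , f = A′ ∨ B′ , a ∨ b , λ K →
    [ inj₁ ∘ proj₁ (e K) , inj₂ ∘ proj₁ (f K) ]′ , [ inj₁ ∘ proj₂ (e K) , inj₂ ∘ proj₂ (f K) ]′
  positive-form (suc n) (A ⇒ B) (s≤s le)
    with normal-form n A (m⊔n≤o⇒m≤o _ _ le) | normal-form n B (m⊔n≤o⇒n≤o _ _ le)
  ... | A′ , a , e | B′ , b , f =
    (A′ ⇒ B′) , gen (∈-++⁺ʳ atoms (∈-cartesianProductWith⁺ _⇒_ a b)) , ⇒-cong e f

  normal-form n E le with positive-form n E le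
  ... | E′ , pos , e with dnf pos
  ... | E″ , m , f = E″ , m , λ K → proj₁ (f K) ∘ proj₁ (e K) , proj₂ (e K) ∘ proj₂ (f K)

  -- NNIL formulas over the parameters: finitely many up to equivalence.

  nnilGens : ℕ → List Fm
  nnils : ℕ → List Fm
  nnilGens zero    = params
  nnilGens (suc k) = params ++ cartesianProductWith _⇒_ params (nnils k)
  nnils k = dnfs (nnilGens k)

  nnils-sound : ∀ k {E} → E ∈ nnils k → NNILpar E × c⇒ E ≤ k
  nnils-sound k = dnfs-closed ((⊥' , ⊥') , z≤n) ((⊤' , ⊤') , z≤n)
    (λ ((a , b) , i) ((c , d) , j) → (a ∧ c , b ∧ d) , ⊔-lub i j)
    (λ ((a , b) , i) ((c , d) , j) → (a ∨ c , b ∨ d) , ⊔-lub i j) (generators k)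
    where
      parameter : ∀ {k E} → E ∈ params → NNILpar E × c⇒ E ≤ k
      parameter m with ∈-map⁻ par m
      ... | p , _ , refl = (par p , par p) , z≤n
      generators : ∀ k {E} → E ∈ nnilGens k → NNILpar E × c⇒ E ≤ k
      generators zero m = parameter m
      generators (suc k) m with ∈-++⁻ params m
      ... | inj₁ a = parameter a
      ... | inj₂ i with ∈-cartesianProductWith⁻ _⇒_ params (nnils k) i
      ... | _ , _ , a , b , refl with ∈-map⁻ par a | nnils-sound k b
      ... | p , _ , refl | (x , y) , le = ((par p ⇒ x) , (par p ⇒ y)) , s≤s le

  -- `Q` lists the parameters that may still fail; the rest have been assumed as antecedents on the
  -- way.
  Full : List (Fin np) → Tree → Set
  Full Q K = ∀ p → p ∈ Q ⊎ (K ⊩ par {nv} p)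

  -- An antecedent par p removes p from Q, so nesting is bounded by the number of parameters.
  Represented : Fm → Set
  Represented C = ∀ k Q → length Q ≤ k →
    ∃ λ E → Positive (nnilGens k) E × (∀ K → Full Q K → (K ⊩ C) ⟺ (K ⊩ E))

  open DecMembership (Fin._≟_ {np}) using (_∈?_)

  params⊆nnilGens : ∀ k {E} → E ∈ params → E ∈ nnilGens k
  params⊆nnilGens zero    m = m
  params⊆nnilGens (suc k) m = ∈-++⁺ˡ m

  represented-∧ : ∀ A B → Represented A → Represented B → Represented (A ∧ B)
  represented-∧ A B ra rb k Q le with ra k Q le | rb k Q le
  ... | A′ , a , e | B′ , b , f = A′ ∧ B′ , a ∧ b , λ K fu →
    (λ (k , l) → proj₁ (e K fu) k , proj₁ (f K fu) l) ,
    (λ (k , l) → proj₂ (e K fu) k , proj₂ (f K fu) l)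

  represented-∨ : ∀ A B → Represented A → Represented B → Represented (A ∨ B)
  represented-∨ A B ra rb k Q le with ra k Q le | rb k Q le
  ... | A′ , a , e | B′ , b , f = A′ ∨ B′ , a ∨ b , λ K fu →
    [ inj₁ ∘ proj₁ (e K fu) , inj₂ ∘ proj₁ (f K fu) ]′ ,
    [ inj₁ ∘ proj₂ (e K fu) , inj₂ ∘ proj₂ (f K fu) ]′

  represented-≋ : ∀ A B → A ≋ B → Represented A → Represented B
  represented-≋ A B eq r k Q le with r k Q le
  ... | E , pos , e = E , pos , λ K fu → proj₁ (e K fu) ∘ proj₂ (eq K) , proj₁ (eq K) ∘ proj₂ (e K fu)

  full-outside : ∀ {Q p K} → ¬ (p ∈ Q) → Full Q K → K ⊩ par p
  full-outside {p = p} p∉Q fu with fu p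
  ... | inj₁ m = ⊥-elim (p∉Q m)
  ... | inj₂ f = f

  full-─ : ∀ {Q p K J} (m : p ∈ Q) → Full Q K → J ⊑ K → J ⊩ par p → Full (Q ─ m) J
  full-─ m fu j x q with fu q
  ... | inj₂ y = inj₂ (persist (par q) j y)
  ... | inj₁ l with ─-∈ m l
  ...   | inj₁ refl = inj₂ x
  ...   | inj₂ l′   = inj₁ l′

  -- If `p` is outside `Q`, it holds already and the antecedent is void. Otherwise assuming it
  -- shortens `Q`, which pays for the level of nesting spent.
  represented-par⇒ : ∀ p {C} → Represented C → Represented (par p ⇒ C)
  represented-par⇒ p {C} r k Q le with p ∈? Q
  ... | no p∉Q with r k Q le
  ...   | E , pos , e = E , pos , λ K fu →
          (λ h → proj₁ (e K fu) (h K root (full-outside p∉Q fu))) ,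
          (λ h J j _ → persist C j (proj₂ (e K fu) h))
  represented-par⇒ p {C} r zero (_ ∷ _) () | yes m
  represented-par⇒ p {C} r (suc k) Q le | yes m
    with r k (Q ─ m) (s≤s⁻¹ (≤-trans (≤-reflexive (─-length m)) le))
  ... | E , pos , e with dnf pos
  ... | E′ , n , f = (par p ⇒ E′) , gen (∈-++⁺ʳ params (∈-cartesianProductWith⁺ _⇒_ (par∈params p) n)) ,
      λ K fu → (λ h J j x → proj₁ (f J) (proj₁ (e J (full-─ m fu j x)) (h J j x))) ,
               (λ h J j x → proj₂ (e J (full-─ m fu j x)) (proj₂ (f J) (h J j x)))

  -- Conjunctive antecedents are curried and disjunctive ones split, until only single parameters
  -- remain, as in `nnilGens`.
  represented-⇒ : ∀ {B} → ImpFree B → ParOnly B → ∀ C → Represented C → Represented (B ⇒ C)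
  represented-⇒ (par p) _ C r = represented-par⇒ p r
  represented-⇒ ⊤' _ C r =
    represented-≋ C (⊤' ⇒ C) (λ K → (λ k J j _ → persist C j k) , λ h → h K root tt) r
  represented-⇒ ⊥' _ C r = λ k Q le → ⊤' , ⊤' , λ K _ → (λ _ → tt) , λ _ _ _ ()
  represented-⇒ (_∧_ {A} {B} a b) (c ∧ d) C r =
    represented-≋ (A ⇒ (B ⇒ C)) (A ∧ B ⇒ C)
      (λ K → (λ h J j (x , y) → h J j x J root y) ,
             (λ h J j x I i y → h I (⊑-trans i j) (persist A i x , y)))
      (represented-⇒ a c (B ⇒ C) (represented-⇒ b d C r))
  represented-⇒ (_∨_ {A} {B} a b) (c ∨ d) C r =
    represented-≋ ((A ⇒ C) ∧ (B ⇒ C)) (A ∨ B ⇒ C)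
      (λ K → (λ (f , g) J j → [ f J j , g J j ]′) ,
             (λ h → (λ J j → h J j ∘ inj₁) , (λ J j → h J j ∘ inj₂)))
      (represented-∧ (A ⇒ C) (B ⇒ C) (represented-⇒ a c C r) (represented-⇒ b d C r))

  represented : ∀ {C} → NNIL C → ParOnly C → Represented C
  represented (par p) _ k Q le = par p , gen (params⊆nnilGens k (par∈params p)) , λ _ _ → id , id
  represented ⊥' _ k Q le = ⊥' , ⊥' , λ _ _ → id , id
  represented ⊤' _ k Q le = ⊤' , ⊤' , λ _ _ → id , id
  represented (_∧_ {A} {B} a b) (c ∧ d) = represented-∧ A B (represented a c) (represented b d)
  represented (_∨_ {A} {B} a b) (c ∨ d) = represented-∨ A B (represented a c) (represented b d)
  represented (_⇒_ {C = C} a b) (c ⇒ d) = represented-⇒ a c C (represented b d)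

  nnil-normal-form : ∀ {C} → NNILpar C → ∃ λ E → E ∈ nnils np × (C ≋ E)
  -- With all parameters in `Q`, every model is full and `np` levels suffice.
  nnil-normal-form (a , b) with represented a b np (allFin np) (≤-reflexive (length-tabulate id))
  ... | E , pos , e with dnf pos
  ... | E′ , m , f = E′ , m , λ K → proj₁ (f K) ∘ proj₁ (e K λ p → inj₁ (∈-allFin p)) ,
                                    proj₂ (e K λ p → inj₁ (∈-allFin p)) ∘ proj₂ (f K)

  -- Ghilardi's projective substitutions

  sub-var : ∀ (E : Fm) → sub var E ≡ E
  sub-var (var x) = refl
  sub-var (par p) = refl
  sub-var ⊥' = refl
  sub-var ⊤' = refl
  sub-var (A ∧ B) = cong₂ _∧_ (sub-var A) (sub-var B)
  sub-var (A ∨ B) = cong₂ _∨_ (sub-var A) (sub-var B)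
  sub-var (A ⇒ B) = cong₂ _⇒_ (sub-var A) (sub-var B)

  sub-cong : ∀ (σ τ : Subst) {K} → (∀ J → J ⊑ K → ∀ x → (J ⊩ σ x) ⟺ (J ⊩ τ x)) →
             ∀ E → (K ⊩ sub σ E) ⟺ (K ⊩ sub τ E)
  sub-cong σ τ {K} h (var x) = h K root x
  sub-cong σ τ h (par p) = id , id
  sub-cong σ τ h ⊥' = id , id
  sub-cong σ τ h ⊤' = id , id
  sub-cong σ τ h (A ∧ B) with sub-cong σ τ h A | sub-cong σ τ h B
  ... | f , g | f′ , g′ = (λ (a , b) → f a , f′ b) , (λ (a , b) → g a , g′ b)
  sub-cong σ τ h (A ∨ B) with sub-cong σ τ h A | sub-cong σ τ h B
  ... | f , g | f′ , g′ = [ inj₁ ∘ f , inj₂ ∘ f′ ]′ , [ inj₁ ∘ g , inj₂ ∘ g′ ]′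
  sub-cong σ τ {K} h (A ⇒ B) =
    (λ k J j a → proj₁ (at j B) (k J j (proj₂ (at j A) a))) ,
    (λ k J j a → proj₂ (at j B) (k J j (proj₁ (at j A) a)))
    where
      at : ∀ {J} → J ⊑ K → ∀ E → (J ⊩ sub σ E) ⟺ (J ⊩ sub τ E)
      at j = sub-cong σ τ λ I i → h I (⊑-trans i j)

  children : Tree → List Tree
  children (node _ _ ts) = ts

  module _ {P : Tree → Set} (P? : ∀ J → Dec (P J)) where

    -- The extension property applies only where all successors behave well; such a point is reached
    -- by moving up through failing successors.
    frontier : ∀ K → ¬ P K → ∃ λ J → J ⊑ K × ¬ P J × (∀ {t} → t ∈ children J → P t)
    frontierAbove : ∀ ts → (∀ {t} → t ∈ ts → P t) ⊎
      ∃ λ t → t ∈ ts × ∃ λ J → J ⊑ t × ¬ P J × (∀ {s} → s ∈ children J → P s)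

    frontier K@(node vs ps ts) ¬p with frontierAbove ts
    ... | inj₁ h = K , root , ¬p , h
    ... | inj₂ (t , m , J , j , r) = J , up m j , r

    frontierAbove [] = inj₁ λ ()
    frontierAbove (t ∷ ts) with P? t | frontierAbove ts
    ... | no ¬p | _ = inj₂ (t , here refl , frontier t ¬p)
    ... | yes p | inj₁ h = inj₁ λ { (here refl) → p ; (there m) → h m }
    ... | yes p | inj₂ (s , m , r) = inj₂ (s , there m , r)

  module Unifier (D : Fm) where

    -- This is `σ` applied after Ghilardi's substitution for the set of variables coded by `a`.
    -- Where `sub σ D` holds nothing changes. At a point refuting it whose proper successors all
    -- force it, a variable in the set becomes true exactly when `σ x` is true above, and every
    -- other variable becomes false.
    step : Vec Bool nv → Subst → Subst
    step a σ x = if lookup a x then sub σ D ⇒ σ x else sub σ D ∧ σ x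

    steps : Subst → List (Vec Bool nv) → Subst
    steps σ []       = σ
    steps σ (a ∷ as) = steps (step a σ) as

    rounds : ℕ → Subst
    rounds zero    = var
    rounds (suc s) = steps (rounds s) (allVecs nv)

    step-fixes : ∀ a σ {K} → K ⊩ sub σ D → ∀ E → (K ⊩ sub (step a σ) E) ⟺ (K ⊩ sub σ E)
    step-fixes a σ {K} k = sub-cong (step a σ) σ λ J j x → at J (persist (sub σ D) j k) x
      where
        at : ∀ J → J ⊩ sub σ D → ∀ x → (J ⊩ step a σ x) ⟺ (J ⊩ σ x)
        at J d x with lookup a x
        ... | true  = (λ h → h J root d) , (λ k I i _ → persist (σ x) i k)
        ... | false = proj₂ , (d ,_)

    steps-fixes : ∀ as σ {K} → K ⊩ sub σ D → ∀ E → (K ⊩ sub (steps σ as) E) ⟺ (K ⊩ sub σ E)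
    steps-fixes []       σ k E = id , id
    steps-fixes (a ∷ as) σ k E
      with step-fixes a σ k E | steps-fixes as (step a σ) (proj₂ (step-fixes a σ k D) k) E
    ... | f , g | f′ , g′ = f ∘ f′ , g′ ∘ g

    rounds-fixes : ∀ s {K} → K ⊩ D → ∀ E → (K ⊩ sub (rounds s) E) ⟺ (K ⊩ E)
    rounds-fixes zero {K} k E = subst (K ⊩_) (sub-var E) , subst (K ⊩_) (sym (sub-var E))
    rounds-fixes (suc s) k E
      with rounds-fixes s k E
         | steps-fixes (allVecs nv) (rounds s) (proj₂ (rounds-fixes s k D) k) E
    ... | f , g | f′ , g′ = f ∘ f′ , g′ ∘ g

    -- The members of gens D forced at a point failing D determine how D behaves there after
    -- a step, because they describe what the points satisfying D above it look like.
    gens : Fm → List Fm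
    gens (var x) = (D ⇒ var x) ∷ []
    gens (par p) = par p ∷ []
    gens ⊥'      = []
    gens ⊤'      = []
    gens (A ∧ B) = gens A ++ gens B
    gens (A ∨ B) = gens A ++ gens B
    gens (A ⇒ B) = (D ∧ A ⇒ B) ∷ gens A ++ gens B

    -- Apart from parameters, generators speak only of points forcing `D`, where the two
    -- substitutions agree. Only this direction can be expected, since `sub τ D` may be forced at
    -- more points than `sub σ D`.
    gens-transfer : ∀ σ τ {K} →
      (∀ J → J ⊑ K → J ⊩ sub σ D → ∀ E → (J ⊩ sub τ E) ⟺ (J ⊩ sub σ E)) →
      ∀ E {F} → F ∈ gens E → K ⊩ sub τ F → K ⊩ sub σ F
    gens-transfer σ τ h (var x) (here refl) k J j d = proj₁ (h J j d (var x)) (k J j (proj₂ (h J j d D) d))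
    gens-transfer σ τ h (par p) (here refl) k = k
    gens-transfer σ τ h (A ∧ B) m = [ gens-transfer σ τ h A , gens-transfer σ τ h B ]′ (∈-++⁻ (gens A) m)
    gens-transfer σ τ h (A ∨ B) m = [ gens-transfer σ τ h A , gens-transfer σ τ h B ]′ (∈-++⁻ (gens A) m)
    gens-transfer σ τ h (A ⇒ B) (here refl) k J j (d , a) =
      proj₁ (h J j d B) (k J j (proj₂ (h J j d D) d , proj₂ (h J j d A) a))
    gens-transfer σ τ h (A ⇒ B) (there m) =
      [ gens-transfer σ τ h A , gens-transfer σ τ h B ]′ (∈-++⁻ (gens A) m)

    -- In a stable model a step makes all points failing D behave alike (see uniform), so that
    -- the right set of variables cannot be spoilt by the wrong ones tried before it.
    Stable : Subst → Tree → Set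
    Stable σ K = ∀ J → J ⊑ K → ¬ (J ⊩ sub σ D) → ∀ {F} → F ∈ gens D → J ⊩ sub σ F → K ⊩ sub σ F

    -- Generators pass from `I` to the root by stability and on to `J` by persistence. They settle
    -- the atoms and, for an implication, the points forcing `sub σ D`; at the points refuting it
    -- the induction hypothesis applies.
    uniform : ∀ a σ {K} → Stable σ K → ∀ E → (∀ {F} → F ∈ gens E → F ∈ gens D) →
      ∀ I J → I ⊑ K → J ⊑ K → ¬ (I ⊩ sub σ D) → ¬ (J ⊩ sub σ D) →
      I ⊩ sub (step a σ) E → J ⊩ sub (step a σ) E
    uniform a σ st (var x) g I J i j ¬i ¬j with lookup a x
    ... | true  = λ h → persist (sub σ (D ⇒ var x)) j (st I i ¬i (g (here refl)) h)
    ... | false = λ (d , _) → ⊥-elim (¬i d)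
    uniform a σ st (par p) g I J i j ¬i ¬j h = persist (par p) j (st I i ¬i (g (here refl)) h)
    uniform a σ st ⊤' g I J i j ¬i ¬j h = tt
    uniform a σ st (A ∧ B) g I J i j ¬i ¬j (h , k) =
      uniform a σ st A (g ∘ ∈-++⁺ˡ) I J i j ¬i ¬j h , uniform a σ st B (g ∘ ∈-++⁺ʳ (gens A)) I J i j ¬i ¬j k
    uniform a σ st (A ∨ B) g I J i j ¬i ¬j (inj₁ h) = inj₁ (uniform a σ st A (g ∘ ∈-++⁺ˡ) I J i j ¬i ¬j h)
    uniform a σ st (A ∨ B) g I J i j ¬i ¬j (inj₂ h) = inj₂ (uniform a σ st B (g ∘ ∈-++⁺ʳ (gens A)) I J i j ¬i ¬j h)
    uniform a σ st (A ⇒ B) g I J i j ¬i ¬j h J′ j′ k with J′ ⊩? sub σ D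
    ... | yes d = proj₂ (step-fixes a σ d B) (DA⇒B J′ (⊑-trans j′ j) (d , proj₁ (step-fixes a σ d A) k))
      where
        DA⇒B = st I i ¬i (g (here refl)) λ I′ i′ (d , x) →
          proj₁ (step-fixes a σ d B) (h I′ i′ (proj₂ (step-fixes a σ d A) x))
    ... | no ¬d = uniform a σ st B (g ∘ there ∘ ∈-++⁺ʳ (gens A)) I J′ i (⊑-trans j′ j) ¬i ¬d
                    (h I root (uniform a σ st A (g ∘ there ∘ ∈-++⁺ˡ) J′ I (⊑-trans j′ j) i ¬d ¬i k))

    -- If a step leaves `D` refuted at the root, uniformity shows that it repaired no other point
    -- either. So `D` holds at the same points as before, stability survives, and the step for `a`
    -- still has its old effect.
    steps-stable : ∀ as σ K {a} → Stable σ K → a ∈ as → K ⊩ sub (step a σ) D → K ⊩ sub (steps σ as) D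
    steps-stable (b ∷ as) σ K {a} st m k with K ⊩? sub (step b σ) D
    ... | yes d = proj₂ (steps-fixes as (step b σ) d D) d
    steps-stable (b ∷ as) σ K {a} st (here refl) k | no ¬d = ⊥-elim (¬d k)
    steps-stable (b ∷ as) σ K {a} st (there m) k | no ¬d = steps-stable as τ K stable′ m right′
      where
        τ = step b σ

        same : ∀ J → J ⊑ K → J ⊩ sub τ D → J ⊩ sub σ D
        same J j d with J ⊩? sub σ D
        ... | yes d′ = d′
        ... | no ¬j  = ⊥-elim (¬d (uniform b σ st D id J K j root ¬j
                                    (λ k → ¬d (proj₂ (step-fixes b σ k D) k)) d))

        stable′ : Stable τ K
        stable′ J j ¬j m f =
          gens-transfer τ σ (λ I i d E → swap (step-fixes b σ (same I i d) E)) D m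
            (st J j (λ d → ¬j (proj₂ (step-fixes b σ d D) d)) m
              (gens-transfer σ τ (λ I i d → step-fixes b σ d) D m f))

        at : ∀ J → J ⊑ K → ∀ x → (J ⊩ step a σ x) ⟺ (J ⊩ step a τ x)
        at J j x with lookup a x
        ... | true  =
          (λ h I i d → let d′ = same I (⊑-trans i j) d in proj₂ (step-fixes b σ d′ (var x)) (h I i d′)) ,
          (λ h I i d → proj₁ (step-fixes b σ d (var x)) (h I i (proj₂ (step-fixes b σ d D) d)))
        ... | false =
          (λ (d , e) → proj₂ (step-fixes b σ d D) d , proj₂ (step-fixes b σ d (var x)) e) ,
          (λ (d , e) → let d′ = same J j d in d′ , proj₁ (step-fixes b σ d′ (var x)) e)

        right′ : K ⊩ sub (step a τ) D
        right′ = proj₁ (sub-cong (step a σ) (step a τ) at D) k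

    -- Ghilardi's extension property relative to `C`. It is asked of every `σ` because the rounds
    -- apply it to whatever substitution has been reached.
    Extendible : Fm → Set
    Extendible C = ∀ σ K → K ⊩ C → (∀ {t} → t ∈ children K → t ⊩ sub σ D) →
      ∃ λ a → K ⊩ sub (step a σ) D

    unforced? : ∀ σ K F → Dec (¬ (K ⊩ sub σ F))
    unforced? σ K F = ¬? (K ⊩? sub σ F)

    rank : Subst → Tree → ℕ
    rank σ K = length (filter (unforced? σ K) (gens D))

    -- Given extendibility, round `s` settles every model of `C` of rank below `s`, and ranks are at
    -- most `length (gens D)`; hence the `suc`.
    unifier : Subst
    unifier = rounds (suc (length (gens D)))

    module _ {C : Fm} (extend : Extendible C) where

      -- If all points of rank < s satisfy D, a model of rank ≤ s is stable or satisfies D; ranks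
      -- only grow from round to round and are at most length (gens D).
      progress : ∀ s σ K → K ⊩ C → (∀ J → J ⊑ K → rank σ J < s → J ⊩ sub σ D) →
        rank (steps σ (allVecs nv)) K ≤ s → K ⊩ sub (steps σ (allVecs nv)) D
      progress s σ K c low le with K ⊩? sub σ D
      ... | yes d = proj₂ (steps-fixes (allVecs nv) σ d D) d
      ... | no ¬k with frontier (λ J → J ⊩? sub σ D) K ¬k
      ...   | J , j , ¬j , above with extend σ J (persist C j c) above
      -- The fitting set of variables is found at `J`, where the extension property applies;
      -- uniformity carries its effect back to `K`.
      ...     | a , d = steps-stable (allVecs nv) σ K stable (∈-allVecs a)
                          (uniform a σ stable D id J K j root ¬j ¬k d)
        where
          τ = steps σ (allVecs nv)
          rank≤s : rank σ K ≤ s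
          rank≤s = ≤-trans (filter-mono (unforced? σ K) (unforced? τ K) (gens D)
                     λ m ¬f f → ¬f (gens-transfer σ τ (λ I i d → steps-fixes (allVecs nv) σ d) D m f)) le
          stable : Stable σ K
          stable J j ¬j {F} m f with K ⊩? sub σ F
          ... | yes k = k
          -- `J` refutes `D` and so has rank at least `s`, while `K` has rank at most `s`; hence
          -- both leave the same generators unforced.
          ... | no ¬k = ⊥-elim (filter-tight (unforced? σ J) (unforced? σ K) (gens D)
                  (λ {F} _ ¬f f → ¬f (persist (sub σ F) j f))
                  (≤-trans rank≤s (≮⇒≥ λ lt → ¬j (low J j lt))) m ¬k f)

      converge : ∀ s K → K ⊩ C → rank (rounds s) K < s → K ⊩ sub (rounds s) D
      converge (suc s) K c (s≤s le) =
        progress s (rounds s) K c (λ J j lt → converge s J (persist C j c) lt) le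

      unifies : ∀ K → K ⊩ C → K ⊩ sub unifier D
      unifies K c = converge _ K c (s≤s (length-filter (unforced? unifier K) (gens D)))

  -- The extension property of the strongest unified formula

  subtrees : Tree → List Tree
  forestSubtrees : List Tree → List Tree
  subtrees K@(node _ _ ts) = K ∷ forestSubtrees ts
  forestSubtrees []       = []
  forestSubtrees (t ∷ ts) = subtrees t ++ forestSubtrees ts

  ∈-forestSubtrees⁺ : ∀ {J t ts} → t ∈ ts → J ∈ subtrees t → J ∈ forestSubtrees ts
  ∈-forestSubtrees⁺ (here refl) k = ∈-++⁺ˡ k
  ∈-forestSubtrees⁺ {ts = s ∷ _} (there m) k = ∈-++⁺ʳ (subtrees s) (∈-forestSubtrees⁺ m k)

  ∈-subtrees⁺ : ∀ {J K} → J ⊑ K → J ∈ subtrees K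
  ∈-subtrees⁺ {node _ _ _} root = here refl
  ∈-subtrees⁺ (up m j)          = there (∈-forestSubtrees⁺ m (∈-subtrees⁺ j))

  ∈-subtrees⁻ : ∀ {J} K → J ∈ subtrees K → J ⊑ K
  ∈-forestSubtrees⁻ : ∀ {J} ts → J ∈ forestSubtrees ts → ∃ λ t → t ∈ ts × J ⊑ t
  ∈-subtrees⁻ (node _ _ ts) (here refl) = root
  ∈-subtrees⁻ (node _ _ ts) (there m) with ∈-forestSubtrees⁻ ts m
  ... | _ , k , j = up k j
  ∈-forestSubtrees⁻ (t ∷ ts) m with ∈-++⁻ (subtrees t) m
  ... | inj₁ k = t , here refl , ∈-subtrees⁻ t k
  ... | inj₂ k with ∈-forestSubtrees⁻ ts k
  ...   | s , l , j = s , there l , j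

  module Strongest (θ : Subst {nv} {np}) (C : Fm) (m : ℕ) where

    consequences : List Fm
    consequences = filter (λ E → ⊢? (C ⇒ sub θ E)) (formulas (suc m))

    D : Fm
    D = ⋀ consequences

    open Unifier D using (step; step-fixes; Extendible)

    D∈candidates : D ∈ map ⋀ (sublists (formulas (suc m)))
    D∈candidates = ∈-map⁺ ⋀ (filter∈sublists (λ E → ⊢? (C ⇒ sub θ E)) (formulas (suc m)))

    D-depth : c⇒ D ≤ suc m
    D-depth = ⋀-closed {Q = λ E → c⇒ E ≤ suc m} z≤n z≤n ⊔-lub ⊔-lub consequences λ k →
      formulas-depth (suc m) (proj₁ (∈-filter⁻ (λ E → ⊢? (C ⇒ sub θ E)) {xs = formulas (suc m)} k))

    C⊩θD : ∀ K → K ⊩ C → K ⊩ sub θ D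
    C⊩θD K c = ⋀-sub⁺ θ consequences λ k →
      valid (proj₂ (∈-filter⁻ (λ E → ⊢? (C ⇒ sub θ E)) {xs = formulas (suc m)} k)) K K root c

    -- `E` is equivalent to an entry of `formulas (suc m)`, which then is a conjunct of `D`. An
    -- arbitrary `σ` is allowed because the claim serves for matching points, for the identity and
    -- for the unifier.
    D-strongest : ∀ E → c⇒ E ≤ suc m → ⊢ (C ⇒ sub θ E) → ∀ σ K → K ⊩ sub σ D → K ⊩ sub σ E
    D-strongest E le d σ K k with normal-form (suc m) E le
    ... | E′ , n , e = proj₂ (≋-sub σ e K) (⋀-sub⁻ σ (∈-filter⁺ (λ E → ⊢? (C ⇒ sub θ E)) n d′) k)
      where
        d′ : ⊢ (C ⇒ sub θ E′)
        d′ = complete λ L J j c → proj₁ (≋-sub θ e J) (valid d L J j c)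

    Matches : Subst → Tree → Tree → Set
    Matches σ J M = M ⊩ C × (∀ E → c⇒ E ≤ m → (J ⊩ sub σ E) ⟺ (M ⊩ sub θ E))

    module _ (σ : Subst {nv} {np}) (J : Tree) where

      forced? : ∀ E → Dec (J ⊩ sub σ E)
      forced? E = J ⊩? sub σ E

      trues falses : List Fm
      trues  = filter forced? (formulas m)
      falses = filter (¬? ∘ forced?) (formulas m)

      -- J refutes ⋀ trues ⇒ ⋁ falses, hence C ⊬ sub θ (⋀ trues ⇒ ⋁ falses) by the choice of D,
      -- and a countermodel has the theory of J.
      type-depth : c⇒ (⋀ trues ⇒ ⋁ falses) ≤ suc m
      type-depth = s≤s (⊔-lub
        (⋀-closed {Q = λ E → c⇒ E ≤ m} z≤n z≤n ⊔-lub ⊔-lub trues λ k →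
          formulas-depth m (proj₁ (∈-filter⁻ forced? {xs = formulas m} k)))
        (⋁-closed {Q = λ E → c⇒ E ≤ m} z≤n z≤n ⊔-lub ⊔-lub falses λ k →
          formulas-depth m (proj₁ (∈-filter⁻ (¬? ∘ forced?) {xs = formulas m} k))))

      type-refuted : ¬ (J ⊩ sub σ (⋀ trues ⇒ ⋁ falses))
      type-refuted h with ⋁-sub⁻ σ falses (h J root (⋀-sub⁺ σ trues λ k →
                            proj₂ (∈-filter⁻ forced? {xs = formulas m} k)))
      ... | E , k , f = proj₂ (∈-filter⁻ (¬? ∘ forced?) {xs = formulas m} k) f

      type-matches : ∀ {M} → M ⊩ sub θ (⋀ trues) → ¬ (M ⊩ sub θ (⋁ falses)) →
                     ∀ E → c⇒ E ≤ m → (J ⊩ sub σ E) ⟺ (M ⊩ sub θ E)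
      type-matches {M} t ¬f E le with normal-form m E le
      ... | E′ , n , e = to , from
        where
          to : J ⊩ sub σ E → M ⊩ sub θ E
          to k = proj₂ (≋-sub θ e M) (⋀-sub⁻ θ (∈-filter⁺ forced? n (proj₁ (≋-sub σ e J) k)) t)
          from : M ⊩ sub θ E → J ⊩ sub σ E
          from k with forced? E
          ... | yes l = l
          ... | no ¬l = ⊥-elim (¬f (⋁-sub⁺ θ
            (∈-filter⁺ (¬? ∘ forced?) n (¬l ∘ proj₂ (≋-sub σ e J))) (proj₁ (≋-sub θ e M) k)))

      match : J ⊩ sub σ D → ∃ (Matches σ J)
      match d with decide (C ⇒ sub θ (⋀ trues ⇒ ⋁ falses))
      ... | inj₁ p = ⊥-elim (type-refuted (D-strongest (⋀ trues ⇒ ⋁ falses) type-depth p σ J d))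
      ... | inj₂ (K , ¬p) with refuted-⇒ C (sub θ (⋀ trues ⇒ ⋁ falses)) K ¬p
      ...   | L , _ , c , ¬q with refuted-⇒ (sub θ (⋀ trues)) (sub θ (⋁ falses)) L ¬q
      ...     | M , j , t , ¬f = M , persist C j c , type-matches t ¬f

    module Glue (σ : Subst {nv} {np}) (vs : Fin nv → Bool) (ps : Fin np → Bool) (ts : List Tree)
                (¬d : ¬ (node vs ps ts ⊩ sub σ D)) (below : ∀ {t} → t ∈ ts → t ⊩ sub σ D) where

      J : Tree
      J = node vs ps ts

      below′ : ∀ {t I} → t ∈ ts → I ⊑ t → I ⊩ sub σ D
      below′ m i = persist (sub σ D) i (below m)

      proper-subtree : ∀ {I} → I ∈ forestSubtrees ts → I ⊑ J × (I ⊩ sub σ D)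
      proper-subtree m with ∈-forestSubtrees⁻ ts m
      ... | t , k , i = up k i , below′ k i

      -- Every proper point of `J` gets a match, not only its successors: in `transfer` an
      -- implication of depth `suc m` is checked at each of them, and matching controls only its two
      -- sides.
      matches = choose {R = Matches σ} (forestSubtrees ts) λ {I} m → match σ I (proj₂ (proper-subtree m))

      -- The variable labels vs at the root of N are arbitrary.
      N : Tree
      N = node vs ps (proj₁ matches)

      forth : ∀ {t I} → t ∈ ts → I ⊑ t → ∃ λ M → M ⊑ N × Matches σ I M
      forth m i with proj₂ (proj₂ matches) (∈-forestSubtrees⁺ m (∈-subtrees⁺ i))
      ... | M , k , r = M , up k root , r

      back : ∀ {M} → M ∈ proj₁ matches → ∃ λ I → I ⊑ J × (I ⊩ sub σ D) × Matches σ I M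
      back k with proj₁ (proj₂ matches) k
      ... | I , m , r = I , proj₁ (proper-subtree m) , proj₂ (proper-subtree m) , r

      a : Vec Bool nv
      a = tabulate λ x → ⌊ N ⊩? θ x ⌋

      σ′ : Subst
      σ′ = step a σ

      -- At the roots the choice of `a` decides the variables; above them an implication is still of
      -- depth at most `m` and is carried over whole by matching.
      same : ∀ E → c⇒ E ≤ m → (J ⊩ sub σ′ E) ⟺ (N ⊩ sub θ E)
      same (var x) le rewrite lookup∘tabulate (λ x → ⌊ N ⊩? θ x ⌋) x with N ⊩? θ x
      ... | no ¬n = (λ (d , _) → ⊥-elim (¬d d)) , λ n → ⊥-elim (¬n n)
      ... | yes n = (λ _ → n) , λ _ → λ
        { _ root d → ⊥-elim (¬d d)
        ; I (up k i) d → let M , j , _ , r = forth k i in proj₂ (r (var x) z≤n) (persist (θ x) j n) }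
      same (par p) le =
        (λ { h _ root → h J root
           ; h L (up k l) → let I , i , _ , _ , r = back k in
                            proj₁ (r (par p) z≤n) (persist (par p) i h) L l }) ,
        (λ { h _ root → h N root
           ; h I (up k i) → let M , j , _ , r = forth k i in
                            proj₂ (r (par p) z≤n) (persist (par p) j h) I root })
      same ⊥' le = id , id
      same ⊤' le = id , id
      same (A ∧ B) le with same A (m⊔n≤o⇒m≤o _ _ le) | same B (m⊔n≤o⇒n≤o _ _ le)
      ... | f , g | f′ , g′ = (λ (x , y) → f x , f′ y) , (λ (x , y) → g x , g′ y)
      same (A ∨ B) le with same A (m⊔n≤o⇒m≤o _ _ le) | same B (m⊔n≤o⇒n≤o _ _ le)
      ... | f , g | f′ , g′ = [ inj₁ ∘ f , inj₂ ∘ f′ ]′ , [ inj₁ ∘ g , inj₂ ∘ g′ ]′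
      same (A ⇒ B) le with same A (m⊔n≤o⇒m≤o _ _ (≤-trans (n≤1+n _) le))
                         | same B (m⊔n≤o⇒n≤o (c⇒ A) _ (≤-trans (n≤1+n _) le))
      ... | f , g | f′ , g′ =
        (λ { h _ root x → f′ (h J root (g x))
           ; h L (up k l) x → let I , i , d , _ , r = back k in
               proj₁ (r (A ⇒ B) le)
                 (proj₁ (step-fixes a σ d (A ⇒ B)) (persist (sub σ′ (A ⇒ B)) i h)) L l x }) ,
        (λ { h _ root x → g′ (h N root (f x))
           ; h I (up k i) x → let M , j , _ , r = forth k i in
               proj₂ (step-fixes a σ (below′ k i) (A ⇒ B))
                 (proj₂ (r (A ⇒ B) le) (persist (sub θ (A ⇒ B)) j h)) I root x })

      -- One level more than `same`, hence one direction only: every proper point of `J` has a match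
      -- in `N`, whereas points inside the matching models need no partner in `J`.
      transfer : ∀ E → c⇒ E ≤ suc m → N ⊩ sub θ E → J ⊩ sub σ′ E
      transfer (var x) le = proj₂ (same (var x) z≤n)
      transfer (par p) le = proj₂ (same (par p) z≤n)
      transfer ⊤' le h = tt
      transfer (A ∧ B) le (h , k) = transfer A (m⊔n≤o⇒m≤o _ _ le) h , transfer B (m⊔n≤o⇒n≤o _ _ le) k
      transfer (A ∨ B) le (inj₁ h) = inj₁ (transfer A (m⊔n≤o⇒m≤o _ _ le) h)
      transfer (A ∨ B) le (inj₂ h) = inj₂ (transfer B (m⊔n≤o⇒n≤o _ _ le) h)
      transfer (A ⇒ B) (s≤s le) h _ root x =
        proj₂ (same B (m⊔n≤o⇒n≤o _ _ le)) (h N root (proj₁ (same A (m⊔n≤o⇒m≤o _ _ le)) x))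
      transfer (A ⇒ B) (s≤s le) h I (up k i) x with forth k i
      ... | M , j , _ , r = proj₂ (step-fixes a σ (below′ k i) B)
        (proj₂ (r B (m⊔n≤o⇒n≤o _ _ le))
          (h M j (proj₁ (r A (m⊔n≤o⇒m≤o _ _ le)) (proj₁ (step-fixes a σ (below′ k i) A) x))))

    extendible : ParOnly C → c⇒ C ≤ m → Extendible C
    extendible po le σ J@(node vs ps ts) c below with J ⊩? sub σ D
    -- When `D` holds at the root already, every step preserves it and any vector will do.
    ... | yes d = replicate _ true , proj₂ (step-fixes (replicate _ true) σ d D) d
    ... | no ¬d = a , transfer D D-depth (C⊩θD N N⊩C)
      where
        open Glue σ vs ps ts ¬d below hiding (J)
        N⊩C : N ⊩ C
        -- Both substitutions fix `C`, so `same` moves `C` itself from `J` to `N`.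
        N⊩C = subst (N ⊩_) (sub-parOnly θ po)
                (proj₁ (same C le) (subst (J ⊩_) (sym (sub-parOnly σ′ po)) c))

  -- Assembling the resolution.

  infix 3 _≼_
  _≼_ : Fm → Fm → Set
  B ≼ C = ⊢ (B ⇒ C)

  open Antichain _≼_ (λ B C → ⊢? (B ⇒ C)) (λ {B} → ⇒I (ax (here refl)))
    (λ d e → ⇒I (⇒E (weaken (λ ()) e) (⇒E (weaken (λ ()) d) (ax (here refl)))))

  module Resolution (A : Fm) where

    open Unifier using (unifier)

    -- `suc m` is then the bound claimed for the resolution, and since `np` is at most `m`, the
    -- listed NNIL formulas have depth at most `m`, as gluing requires.
    m : ℕ
    m = pred (c⇒ A) ⊔ np

    m-bound : suc m ≡ c⇒ A ⊔ suc np
    m-bound with c⇒ A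
    ... | zero  = refl
    ... | suc _ = refl

    A-depth : c⇒ A ≤ suc m
    A-depth = subst (c⇒ A ≤_) (sym m-bound) (m≤m⊔n _ _)

    Good : Fm → Set
    Good D = ⊢ (D ⇒ A) × Any (λ C → ⊢ (sub (unifier D) D ⇔ C)) (nnils np)

    good? : ∀ D → Dec (Good D)
    good? D = ⊢? (D ⇒ A) ×-dec any? (λ C → ⊢? (sub (unifier D) D ⇔ C)) (nnils np)

    candidates goods Π : List Fm
    candidates = map ⋀ (sublists (formulas (suc m)))
    goods = filter good? candidates
    Π = prune goods

    Π-good : ∀ {B} → B ∈ Π → B ∈ candidates × Good B
    Π-good b = ∈-filter⁻ good? {xs = candidates} (prune-⊆ goods b)

    depth : ∀ {B} → B ∈ Π → c⇒ B ≤ c⇒ A ⊔ suc np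
    depth b with ∈-map⁻ ⋀ (proj₁ (Π-good b))
    ... | X , x , refl = subst (c⇒ (⋀ X) ≤_) m-bound
      (⋀-closed {Q = λ E → c⇒ E ≤ suc m} z≤n z≤n ⊔-lub ⊔-lub X
        λ k → formulas-depth (suc m) (sublists-⊆ (formulas (suc m)) x k))

    ∷-complete : ∀ {B E} → (∀ K → K ⊩ B → K ⊩ E) → B ∷ [] ⊢ E
    ∷-complete h = ⇒E (weaken (λ ()) (complete λ _ J _ → h J)) (ax (here refl))

    -- The rounds change no formula at points forcing `B`, and parameters are never moved.
    unifier-projective : ∀ B → AProjective B (unifier B)
    unifier-projective B =
      (λ x → ∷-complete λ K b →
        (λ J j → proj₂ (fixes J (persist B j b) (var x))) ,
        (λ J j → proj₁ (fixes J (persist B j b) (var x)))) ,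
      (λ p → ∷-complete λ K b → (λ J j → id) , (λ J j → id))
      where
        fixes : ∀ J → J ⊩ B → ∀ E → (J ⊩ sub (unifier B) E) ⟺ (J ⊩ E)
        fixes J = Unifier.rounds-fixes B (suc (length (Unifier.gens B B)))

    projective : ∀ {B} → B ∈ Π → ΓProjective NNILpar B
    projective {B} b with find (proj₂ (proj₂ (Π-good b)))
    ... | C , c , e = unifier B , C , unifier-projective B , proj₁ (nnils-sound np c) , e

    derivable : ⊢ (⋁ Π ⇒ A)
    derivable = complete λ _ J _ j → let B , b , k = ⋁⁻ Π j in
      valid (proj₁ (proj₂ (Π-good b))) J J root k

    -- Up to equivalence `A` is among the formulas that `θ` unifies relative to `C`, so `D` proves
    -- it. So is `C`, which substitutions fix: hence the unifier's image of `D` proves `C`, and the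
    -- extension property gives the converse.
    good-consequence : ∀ θ C → C ∈ nnils np → ⊢ (C ⇒ sub θ A) → Good (Strongest.D θ C m)
    good-consequence θ C c d = ≼A , lose c (≋⇒⊢ λ K → to K , Unifier.unifies D (extendible po le) K)
      where
        open Strongest θ C m
        po = proj₂ (proj₁ (nnils-sound np c))
        le = ≤-trans (proj₂ (nnils-sound np c)) (m≤n⊔m (pred (c⇒ A)) np)

        below : ∀ E → c⇒ E ≤ suc m → ⊢ (C ⇒ sub θ E) → ∀ K → K ⊩ D → K ⊩ E
        below E le d K k = subst (K ⊩_) (sub-var E)
          (D-strongest E le d var K (subst (K ⊩_) (sym (sub-var D)) k))

        ≼A : D ≼ A
        ≼A = complete λ _ J _ → below A A-depth d J

        to : ∀ K → K ⊩ sub (unifier D) D → K ⊩ C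
        to K k = subst (K ⊩_) (sub-parOnly (unifier D) po)
          (D-strongest C (≤-trans le (n≤1+n m))
            (subst (λ E → ⊢ (C ⇒ E)) (sym (sub-parOnly θ po)) (⇒I (ax (here refl)))) (unifier D) K k)

    -- Once `C` is replaced by its normal form `C′`, the strongest formula for `θ` and `C′` is good
    -- and lies below some member of `Π`. As `C′` proves its `θ`-image, it proves that of the member
    -- too.
    admissible : Admissible NNILpar A (⋁ Π)
    admissible θ C nnil d with nnil-normal-form nnil
    ... | C′ , c , e with prune-cover goods (∈-filter⁺ good? D∈candidates (good-consequence θ C′ c d′))
      where
        open Strongest θ C′ m
        d′ : ⊢ (C′ ⇒ sub θ A)
        d′ = complete λ K J _ c → valid d J J root
               (subst (J ⊩_) (sym (sub-parOnly θ (proj₂ nnil))) (proj₂ (e J) c))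
    ... | B , b , D≼B = complete λ _ J _ c → ⋁-sub⁺ θ b
      (valid (sub-⊢ θ D≼B) J J root
        (Strongest.C⊩θD θ C′ m J (proj₁ (e J) (subst (J ⊩_) (sub-parOnly θ (proj₂ nnil)) c))))

    resolution : ProjResolution NNILpar A Π
    resolution = record
      { antichain  = prune-antichain goods
      ; projective = projective
      ; admissible = admissible
      ; derivable  = derivable
      }

theorem3p27 : (nv np : ℕ) → (A : Form nv np) →
    Σ (List (Form nv np)) λ Π →
    ProjResolution NNILpar A Π ×
    (∀ {B} → B ∈ Π → c⇒ B ≤ c⇒ A ⊔ suc np)
theorem3p27 nv np A = Π , resolution , depth
  where open Resolution A
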